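{- For the multiple-choice secretary problem with regret minimization as the objective, there exists an algorithm whose worst-case regret is $O(\sqrt{k})$.
   Context: Multiple-choice secretary problem: $n$ adversarially chosen values in $[0,1]$ arrive in a uniformly random order; an online algorithm must irrevocably decide upon each arrival whether to select it, and may select at most $k$ values. The regret on an instance is the sum of the $k$ largest values minus the expected sum of the selected values; the worst-case regret is the supremum over all $n$ and all instances.
   Formalization: The adversarially chosen values are rational numbers in [0,1] instead of arbitrary real numbers in [0,1], and the algorithm is defined on rational values only. -}

module Defs where

open import Data.Bool using (Bool; if_then_else_)
open import Data.Nat as ℕ using (ℕ; zero; suc)
open import Data.Fin using (Fin)
open import Data.Integer using (+_)
open import Data.List using (List; []; _∷_; [_]; map; concatMap; take; reverse; length; foldr; allFin; _++_)
open import Data.List.Relation.Unary.All using (All)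
open import Data.Product using (Σ; _×_)
open import Data.Rational using (ℚ; 0ℚ; 1ℚ; _+_; _-_; _*_; _/_; _≤_)
open import Data.Rational.Properties using (≤-decTotalOrder)
import Data.List.Sort

sumℚ : List ℚ → ℚ
sumℚ = foldr _+_ 0ℚ

avg : List ℚ → ℚ
avg []       = 0ℚ
avg (x ∷ xs) = sumℚ (x ∷ xs) * ((+ 1) / suc (length xs))

insertAll : {A : Set} → A → List A → List (List A)
insertAll x []       = [ x ∷ [] ]
insertAll x (y ∷ ys) = (x ∷ y ∷ ys) ∷ map (y ∷_) (insertAll x ys)

-- all n! arrival orders of a list of n items (one per permutation of positions,
-- so duplicated values are counted with multiplicity)
perms : {A : Set} → List A → List (List A)
perms []       = [ [] ]
perms (x ∷ xs) = concatMap (insertAll x) (perms xs)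

sortℚ : List ℚ → List ℚ
sortℚ = Data.List.Sort.sort ≤-decTotalOrder

topK : ℕ → List ℚ → ℚ
topK k xs = sumℚ (take k (reverse (sortℚ xs)))

-- An online (possibly randomised) algorithm.  Given n and k it fixes a finite
-- uniform random seed space Fin (suc m) and, for each seed, a decision rule that
-- upon each arrival sees the history of values seen so far (in arrival order)
-- and the current value, and decides whether to select it.
Decision : Set
Decision = List ℚ → ℚ → Bool

Algorithm : Set
Algorithm = (n k : ℕ) → Σ ℕ (λ m → Fin (suc m) → Decision)

run : Decision → ℕ → List ℚ → List ℚ → ℚ
run d c       h []       = 0ℚ
run d zero    h (x ∷ xs) = 0ℚ
run d (suc c) h (x ∷ xs) =
  if d h x then x + run d c (h ++ [ x ]) xs
           else run d (suc c) (h ++ [ x ]) xs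

expectedGain : Algorithm → ℕ → List ℚ → ℚ
expectedGain A k xs with A (length xs) k
... | m Data.Product., D =
  avg (map (λ s → avg (map (run (D s) k []) (perms xs))) (allFin (suc m)))

regret : Algorithm → ℕ → List ℚ → ℚ
regret A k xs = topK k xs - expectedGain A k xs

InUnit : ℚ → Set
InUnit x = (0ℚ ≤ x) × (x ≤ 1ℚ)

{-# OPTIONS --safe #-}

-- Let κ = min k n.  The t-th arrival is accepted when its rank among the first t values is at
-- most κt/n, where ties and the fractional part of κt/n are resolved by fresh randomness so that
-- the expected number of accepted values is exactly κ/n per step, whatever came before.
--
-- Overflow: the acceptance indicators are independent, so the number of acceptances has mean κ
-- and variance at most κ, and the capacity k costs O(√k) in expectation.
--
-- Value: the acceptance probabilities q of step t form an optimal fractional choice of κt/n items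
-- out of the set S of the first t.  Let w be the optimal fractional choice of κ items out of the
-- whole instance.  Comparing q with w on S loses at most the excess of w(S) over its mean κt/n.
-- Uncovering the items from last to first, the expected loss is controlled by a potential
-- quadratic in the drift w(S) − κt/n, with coefficients of order √(n/(kt)), and summing to O(√k).
-- Rational substitutes for the square roots are the products ∏_{s ≤ t} (1 − 1/(2s)) ≈ 1/√t.

module Submission where

open import Defs
open import Data.Bool using (Bool; true; false; if_then_else_)
open import Data.Empty using (⊥-elim)
open import Data.Fin using (Fin)
open import Data.Integer as ℤ using (+_)
import Data.Integer.Properties as ℤₚ
import Data.Nat
open import Data.Nat as ℕ using (ℕ; zero; suc; _!; _⊓_; z≤n; s≤s)
open import Data.Nat.Divisibility using (divides; ∣-trans; m≤n⇒m!∣n!; m∣m*n)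
import Data.Nat.Properties as ℕₚ
open import Data.Nat.Tactic.RingSolver using () renaming (solve-∀ to solveℕ-∀)
open import Data.List using (List; []; _∷_; [_]; _++_; _∷ʳ_; allFin; concatMap; downFrom; length; lookup; map; reverse; take)
open import Data.List.Membership.Propositional using (_∈_)
open import Data.List.Membership.Propositional.Properties using (∈-concatMap⁻; ∈-downFrom⁻; ∈-map⁻)
open import Data.List.Properties using (++-assoc; ++-identityʳ; length-++; length-downFrom; length-map; length-take; map-tabulate; tabulate-lookup; unfold-reverse)
open import Data.List.Relation.Binary.Permutation.Propositional using (_↭_; refl; prep; swap; trans; ↭-refl; ↭-sym; ↭-trans)
open import Data.List.Relation.Binary.Permutation.Propositional.Properties using (All-resp-↭; ∈-resp-↭; ↭-length; ↭-reverse; ∷↭∷ʳ)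
open import Data.List.Relation.Unary.All as All using (All; []; _∷_)
open import Data.List.Relation.Unary.AllPairs using (AllPairs; []; _∷_)
open import Data.List.Relation.Unary.AllPairs.Properties using (++⁺)
open import Data.List.Relation.Unary.Any using (Any; here; there)
open import Data.List.Relation.Unary.Sorted.TotalOrder.Properties using (Sorted⇒AllPairs)
import Data.List.Sort
open import Data.Product using (Σ; ∃; _×_; _,_; map₂; proj₁; proj₂)
open import Data.Rational hiding (truncate; _⊓_)
open import Data.Rational.Properties
open import Data.Rational.Unnormalised as ℚᵘ using (mkℚᵘ; *≡*)
import Data.Rational.Unnormalised.Properties as ℚᵘₚ
open import Data.Sum using (_⊎_; inj₁; inj₂)
open import Function using (_∘_; flip; id)
open import Relation.Binary.Bundles using (module DecTotalOrder)
open import Relation.Binary.Definitions using (tri<; tri≈; tri>)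
open import Relation.Binary.PropositionalEquality as ≡ using (_≡_; cong; cong₂; sym; subst; subst₂; module ≡-Reasoning)
open import Relation.Nullary using (¬_; yes; no; does)
open import Relation.Nullary.Decidable using (dec-false; dec-true)
open import Relation.Nullary.Decidable.Core using (dec⇒maybe)
open import Tactic.RingSolver using (solve-∀)
open import Tactic.RingSolver.Core.AlmostCommutativeRing using (AlmostCommutativeRing; fromCommutativeRing)

-- The obstacle is the square root: over `ℚ`, neither the passage from a second moment to a mean
-- absolute deviation nor the bound √k can be stated. Every deviation z is therefore majorised by η
-- z² + ρ with η ρ ≥ 1/4, so that only second moments occur, and these obey exact recursions. The
-- recursions peel off the last arrival. Given the set of the first t arrivals, the t-th is uniform
-- in it, and its acceptance depends on that set, on the item and on a fresh seed, but not on the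
-- order of the earlier items. What remains is the same situation on t - 1 items, so all inductions
-- run over sets of items and not over histories. Fractional choices are functions of the value
-- alone. Equal items share their weight equally, and a choice made on the whole instance restricts
-- to any subset without tracking positions. Since the theorem bounds the square of the regret, the
-- regret must also be shown nonnegative. Linear programming duality is thus used in both
-- directions: to compare the best k items with the fractional optimum, and to show that no run of
-- capacity k beats them.

ℚ-ring : AlmostCommutativeRing _ _
ℚ-ring = fromCommutativeRing +-*-commutativeRing (λ x → dec⇒maybe (0ℚ ≟ x))

-- Rational arithmetic

+-nonneg : ∀ {x y} → 0ℚ ≤ x → 0ℚ ≤ y → 0ℚ ≤ x + y
+-nonneg {x} {y} = +-mono-≤ {0ℚ} {x} {0ℚ} {y}

*-nonneg : ∀ {x y} → 0ℚ ≤ x → 0ℚ ≤ y → 0ℚ ≤ x * y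
*-nonneg {x} {y} 0≤x 0≤y =
  subst (_≤ x * y) (*-zeroʳ x) (*-monoˡ-≤-nonNeg x {{nonNegative 0≤x}} 0≤y)

*-monoˡ : ∀ {x y z} → 0ℚ ≤ z → x ≤ y → z * x ≤ z * y
*-monoˡ {z = z} 0≤z = *-monoˡ-≤-nonNeg z {{nonNegative 0≤z}}

*-mono : ∀ {x y u v} → 0ℚ ≤ x → 0ℚ ≤ v → x ≤ y → u ≤ v → x * u ≤ y * v
*-mono {x} {y} {u} {v} 0≤x 0≤v x≤y u≤v =
  ≤-trans (*-monoˡ 0≤x u≤v) (*-monoʳ-≤-nonNeg v {{nonNegative 0≤v}} x≤y)

≤-slack : ∀ {x y} e → y ≡ x + e → 0ℚ ≤ e → x ≤ y
≤-slack {x} {y} e y≡ 0≤e =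
  subst₂ _≤_ (+-identityʳ x) (sym y≡) (+-monoʳ-≤ x 0≤e)

0≤y-x : ∀ {x y} → x ≤ y → 0ℚ ≤ y - x
0≤y-x {x} {y} x≤y = subst (_≤ y - x) (+-inverseʳ x) (+-monoˡ-≤ (- x) x≤y)

square-nonneg : ∀ x → 0ℚ ≤ x * x
square-nonneg x with ≤-total 0ℚ x
... | inj₁ 0≤x = *-nonneg 0≤x 0≤x
... | inj₂ x≤0 = subst (0ℚ ≤_) (neg² x) (*-nonneg 0≤-x 0≤-x)
  where
  0≤-x : 0ℚ ≤ - x
  0≤-x = neg-antimono-≤ x≤0
  neg² : ∀ x → - x * - x ≡ x * x
  neg² = solve-∀ ℚ-ring

0≤1 : 0ℚ ≤ 1ℚ
0≤1 = *≤* (ℤ.+≤+ ℕ.z≤n)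

-- Natural numbers and their reciprocals in `ℚ`

ι : ℕ → ℚ
ι zero    = 0ℚ
ι (suc n) = 1ℚ + ι n

-- The value 0 at `zero` makes `inv` multiplicative without side conditions and gives empty lists
-- mean 0.
inv : ℕ → ℚ
inv zero    = 0ℚ
inv (suc n) = + 1 / suc n

ι-+ : ∀ m n → ι (m ℕ.+ n) ≡ ι m + ι n
ι-+ zero    n = sym (+-identityˡ (ι n))
ι-+ (suc m) n = ≡.trans (cong (λ x → 1ℚ + x) (ι-+ m n)) (sym (+-assoc 1ℚ (ι m) (ι n)))

ι-* : ∀ m n → ι (m ℕ.* n) ≡ ι m * ι n
ι-* zero    n = sym (*-zeroˡ (ι n))
ι-* (suc m) n = ≡.trans (ι-+ n (m ℕ.* n)) (≡.trans (cong (λ x → ι n + x) (ι-* m n)) (lemma (ι n) (ι m)))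
  where
  lemma : ∀ x y → x + y * x ≡ (1ℚ + y) * x
  lemma = solve-∀ ℚ-ring

ι-nonneg : ∀ n → 0ℚ ≤ ι n
ι-nonneg zero    = ≤-refl
ι-nonneg (suc n) = +-nonneg {1ℚ} {ι n} 0≤1 (ι-nonneg n)

ι-mono : ∀ {m n} → m ℕ.≤ n → ι m ≤ ι n
ι-mono {n = n} ℕ.z≤n = ι-nonneg n
ι-mono (ℕ.s≤s m≤n)   = +-monoʳ-≤ 1ℚ (ι-mono m≤n)

ι≡/1 : ∀ n → ι n ≡ + n / 1
ι≡/1 zero    = ≡.refl
ι≡/1 (suc n) = ≡.trans (cong (λ x → 1ℚ + x) (ι≡/1 n)) (toℚᵘ-injective eq)
  where
  open ℚᵘₚ.≃-Reasoning
  eq : toℚᵘ (1ℚ + + n / 1) ℚᵘ.≃ toℚᵘ (+ suc n / 1)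
  eq = begin
    toℚᵘ (1ℚ + + n / 1)                ≈⟨ toℚᵘ-homo-+ 1ℚ (+ n / 1) ⟩
    toℚᵘ 1ℚ ℚᵘ.+ toℚᵘ (+ n / 1)        ≈⟨ ℚᵘₚ.+-congʳ (toℚᵘ 1ℚ) (toℚᵘ-fromℚᵘ (mkℚᵘ (+ n) 0)) ⟩
    mkℚᵘ (+ 1) 0 ℚᵘ.+ mkℚᵘ (+ n) 0     ≈⟨ *≡* (cong (λ x → (+ 1 ℤ.+ x) ℤ.* + 1) (ℤₚ.*-identityʳ (+ n))) ⟩
    mkℚᵘ (+ suc n) 0                   ≈⟨ toℚᵘ-fromℚᵘ (mkℚᵘ (+ suc n) 0) ⟨
    toℚᵘ (+ suc n / 1)                 ∎

ι*inv : ∀ n → ι (suc n) * inv (suc n) ≡ 1ℚ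
ι*inv n = ≡.trans (cong (_* inv (suc n)) (ι≡/1 (suc n))) (toℚᵘ-injective eq)
  where
  open ℚᵘₚ.≃-Reasoning
  eq : toℚᵘ ((+ suc n / 1) * (+ 1 / suc n)) ℚᵘ.≃ toℚᵘ 1ℚ
  eq = begin
    toℚᵘ ((+ suc n / 1) * (+ 1 / suc n))          ≈⟨ toℚᵘ-homo-* (+ suc n / 1) (+ 1 / suc n) ⟩
    toℚᵘ (+ suc n / 1) ℚᵘ.* toℚᵘ (+ 1 / suc n)    ≈⟨ ℚᵘₚ.*-cong (toℚᵘ-fromℚᵘ (mkℚᵘ (+ suc n) 0)) (toℚᵘ-fromℚᵘ (mkℚᵘ (+ 1) n)) ⟩
    mkℚᵘ (+ suc n) 0 ℚᵘ.* mkℚᵘ (+ 1) n            ≈⟨ *≡* (cong +_ (≡.trans (ℕₚ.*-identityʳ _) (≡.trans (ℕₚ.*-identityʳ _) (sym (≡.trans (ℕₚ.+-identityʳ _) (ℕₚ.+-identityʳ _)))))) ⟩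
    toℚᵘ 1ℚ                                       ∎

inv-nonneg : ∀ n → 0ℚ ≤ inv n
inv-nonneg zero    = ≤-refl
inv-nonneg (suc n) = nonNegative⁻¹ (inv (suc n)) {{normalize-nonNeg 1 (suc n)}}

inv-unique : ∀ n {x} → ι (suc n) * x ≡ 1ℚ → x ≡ inv (suc n)
inv-unique n {x} eq = begin
  x                                ≡⟨ lemma x (ι (suc n)) (inv (suc n)) (ι*inv n) ⟩
  inv (suc n) * (ι (suc n) * x)    ≡⟨ cong (λ y → inv (suc n) * y) eq ⟩
  inv (suc n) * 1ℚ                 ≡⟨ *-identityʳ (inv (suc n)) ⟩
  inv (suc n)                      ∎
  where
  open ≡-Reasoning
  reorder : ∀ x y z → (y * z) * x ≡ z * (y * x)
  reorder = solve-∀ ℚ-ring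
  lemma : ∀ x y z → y * z ≡ 1ℚ → x ≡ z * (y * x)
  lemma x y z yz≡1 = ≡.trans (sym (≡.trans (cong (_* x) yz≡1) (*-identityˡ x))) (reorder x y z)

inv-* : ∀ m n → inv (m ℕ.* n) ≡ inv m * inv n
inv-* zero    n       = sym (*-zeroˡ (inv n))
inv-* (suc m) zero    = ≡.trans (cong inv (ℕₚ.*-zeroʳ m)) (sym (*-zeroʳ (inv (suc m))))
inv-* (suc m) (suc n) = sym (inv-unique (n ℕ.+ m ℕ.* suc n) (begin
  ι (suc m ℕ.* suc n) * (inv (suc m) * inv (suc n))          ≡⟨ cong (_* (inv (suc m) * inv (suc n))) (ι-* (suc m) (suc n)) ⟩
  ι (suc m) * ι (suc n) * (inv (suc m) * inv (suc n))        ≡⟨ lemma (ι (suc m)) (ι (suc n)) (inv (suc m)) (inv (suc n)) ⟩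
  (ι (suc m) * inv (suc m)) * (ι (suc n) * inv (suc n))      ≡⟨ cong₂ _*_ (ι*inv m) (ι*inv n) ⟩
  1ℚ                                                         ∎))
  where
  open ≡-Reasoning
  lemma : ∀ x y z w → x * y * (z * w) ≡ (x * z) * (y * w)
  lemma = solve-∀ ℚ-ring

-- Finite sums and means

∑ : {A : Set} → List A → (A → ℚ) → ℚ
∑ []      f = 0ℚ
∑ (x ∷ l) f = f x + ∑ l f

mean : {A : Set} → List A → (A → ℚ) → ℚ
mean l f = inv (length l) * ∑ l f

module _ {A : Set} where

  ∑-cong : ∀ (l : List A) {f g} → (∀ {x} → x ∈ l → f x ≡ g x) → ∑ l f ≡ ∑ l g
  ∑-cong []      eq = ≡.refl
  ∑-cong (x ∷ l) eq = cong₂ _+_ (eq (here ≡.refl)) (∑-cong l (eq ∘ there))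

  ∑-mono : ∀ (l : List A) {f g} → (∀ {x} → x ∈ l → f x ≤ g x) → ∑ l f ≤ ∑ l g
  ∑-mono []      le = ≤-refl
  ∑-mono (x ∷ l) le = +-mono-≤ (le (here ≡.refl)) (∑-mono l (le ∘ there))

  ∑-+ : ∀ (l : List A) f g → ∑ l (λ x → f x + g x) ≡ ∑ l f + ∑ l g
  ∑-+ []      f g = ≡.refl
  ∑-+ (x ∷ l) f g = ≡.trans (cong (λ y → f x + g x + y) (∑-+ l f g)) (lemma (f x) (g x) (∑ l f) (∑ l g))
    where
    lemma : ∀ x y z w → x + y + (z + w) ≡ x + z + (y + w)
    lemma = solve-∀ ℚ-ring

  ∑-* : ∀ (l : List A) c f → ∑ l (λ x → c * f x) ≡ c * ∑ l f
  ∑-* []      c f = sym (*-zeroʳ c)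
  ∑-* (x ∷ l) c f = ≡.trans (cong (λ y → c * f x + y) (∑-* l c f)) (sym (*-distribˡ-+ c (f x) (∑ l f)))

  ∑-const : ∀ (l : List A) c → ∑ l (λ _ → c) ≡ ι (length l) * c
  ∑-const []      c = sym (*-zeroˡ c)
  ∑-const (x ∷ l) c = ≡.trans (cong (λ y → c + y) (∑-const l c)) (lemma c (ι (length l)))
    where
    lemma : ∀ x y → x + y * x ≡ (1ℚ + y) * x
    lemma = solve-∀ ℚ-ring

  ∑-nonneg : ∀ (l : List A) {f} → (∀ {x} → x ∈ l → 0ℚ ≤ f x) → 0ℚ ≤ ∑ l f
  ∑-nonneg []      nn = ≤-refl
  ∑-nonneg (x ∷ l) nn = +-nonneg (nn (here ≡.refl)) (∑-nonneg l (nn ∘ there))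

  ∑-++ : ∀ (l m : List A) f → ∑ (l ++ m) f ≡ ∑ l f + ∑ m f
  ∑-++ []      m f = sym (+-identityˡ (∑ m f))
  ∑-++ (x ∷ l) m f = ≡.trans (cong (λ y → f x + y) (∑-++ l m f)) (sym (+-assoc (f x) (∑ l f) (∑ m f)))

  ∑-↭ : ∀ {l m : List A} f → l ↭ m → ∑ l f ≡ ∑ m f
  ∑-↭ f refl                = ≡.refl
  ∑-↭ f (prep x p)          = cong (λ y → f x + y) (∑-↭ f p)
  ∑-↭ f (swap {l} {m} x y p) = ≡.trans (cong (λ z → f x + (f y + z)) (∑-↭ f p)) (lemma (f x) (f y) (∑ m f))
    where
    lemma : ∀ x y z → x + (y + z) ≡ y + (x + z)
    lemma = solve-∀ ℚ-ring
  ∑-↭ f (trans p q)         = ≡.trans (∑-↭ f p) (∑-↭ f q)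

  mean-cong : ∀ (l : List A) {f g} → (∀ {x} → x ∈ l → f x ≡ g x) → mean l f ≡ mean l g
  mean-cong l eq = cong (λ y → inv (length l) * y) (∑-cong l eq)

  mean-mono : ∀ (l : List A) {f g} → (∀ {x} → x ∈ l → f x ≤ g x) → mean l f ≤ mean l g
  mean-mono l le = *-monoˡ (inv-nonneg (length l)) (∑-mono l le)

  mean-+ : ∀ (l : List A) f g → mean l (λ x → f x + g x) ≡ mean l f + mean l g
  mean-+ l f g = ≡.trans (cong (λ y → inv (length l) * y) (∑-+ l f g)) (*-distribˡ-+ (inv (length l)) (∑ l f) (∑ l g))

  mean-* : ∀ (l : List A) c f → mean l (λ x → c * f x) ≡ c * mean l f
  mean-* l c f = ≡.trans (cong (λ y → inv (length l) * y) (∑-* l c f)) (lemma (inv (length l)) c (∑ l f))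
    where
    lemma : ∀ x y z → x * (y * z) ≡ y * (x * z)
    lemma = solve-∀ ℚ-ring

  mean-const : ∀ (l : List A) c → 0 ℕ.< length l → mean l (λ _ → c) ≡ c
  mean-const (x ∷ l) c _ = ≡.trans (cong (λ y → inv (suc (length l)) * y) (∑-const (x ∷ l) c))
    (lemma (inv (suc (length l))) (ι (suc (length l))) c (ι*inv (length l)))
    where
    reorder : ∀ x y c → x * (y * c) ≡ (y * x) * c
    reorder = solve-∀ ℚ-ring
    lemma : ∀ x y c → y * x ≡ 1ℚ → x * (y * c) ≡ c
    lemma x y c yx≡1 = ≡.trans (reorder x y c) (≡.trans (cong (_* c) yx≡1) (*-identityˡ c))

module _ {A B : Set} where

  ∑-map : ∀ (g : A → B) l f → ∑ (map g l) f ≡ ∑ l (f ∘ g)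
  ∑-map g []      f = ≡.refl
  ∑-map g (x ∷ l) f = cong (λ y → f (g x) + y) (∑-map g l f)

  ∑-concatMap : ∀ (g : A → List B) l f → ∑ (concatMap g l) f ≡ ∑ l (λ x → ∑ (g x) f)
  ∑-concatMap g []      f = ≡.refl
  ∑-concatMap g (x ∷ l) f = ≡.trans (∑-++ (g x) (concatMap g l) f) (cong (λ y → ∑ (g x) f + y) (∑-concatMap g l f))

  ∑-swap : ∀ (l : List A) (m : List B) (f : A → B → ℚ) →
           ∑ l (λ x → ∑ m (f x)) ≡ ∑ m (λ y → ∑ l (λ x → f x y))
  ∑-swap []      m f = sym (≡.trans (∑-const m 0ℚ) (*-zeroʳ (ι (length m))))
  ∑-swap (x ∷ l) m f = ≡.trans (cong (λ y → ∑ m (f x) + y) (∑-swap l m f)) (sym (∑-+ m (f x) (λ y → ∑ l (λ x → f x y))))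

  mean-map : ∀ (g : A → B) l f → mean (map g l) f ≡ mean l (f ∘ g)
  mean-map g l f = cong₂ (λ a b → inv a * b) (length-map g l) (∑-map g l f)

  mean-swap : ∀ (l : List A) (m : List B) (f : A → B → ℚ) →
              mean l (λ x → mean m (f x)) ≡ mean m (λ y → mean l (λ x → f x y))
  mean-swap l m f = begin
    i * ∑ l (λ x → j * ∑ m (f x))                 ≡⟨ cong (λ y → i * y) (∑-* l j _) ⟩
    i * (j * ∑ l (λ x → ∑ m (f x)))               ≡⟨ cong (λ y → i * (j * y)) (∑-swap l m f) ⟩
    i * (j * ∑ m (λ y → ∑ l (λ x → f x y)))       ≡⟨ lemma i j _ ⟩
    j * (i * ∑ m (λ y → ∑ l (λ x → f x y)))       ≡⟨ cong (λ y → j * y) (sym (∑-* m i _)) ⟩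
    j * ∑ m (λ y → i * ∑ l (λ x → f x y))         ∎
    where
    open ≡-Reasoning
    i = inv (length l)
    j = inv (length m)
    lemma : ∀ x y z → x * (y * z) ≡ y * (x * z)
    lemma = solve-∀ ℚ-ring

  length-concatMap : ∀ (g : A → List B) l {c} → (∀ {x} → x ∈ l → length (g x) ≡ c) →
                     length (concatMap g l) ≡ length l ℕ.* c
  length-concatMap g []      eq = ≡.refl
  length-concatMap g (x ∷ l) eq =
    ≡.trans (length-++ (g x)) (cong₂ ℕ._+_ (eq (here ≡.refl)) (length-concatMap g l (eq ∘ there)))

  mean-concatMap : ∀ (g : A → List B) l f {c} → (∀ {x} → x ∈ l → length (g x) ≡ c) →
                   mean (concatMap g l) f ≡ mean l (λ x → mean (g x) f)
  mean-concatMap g l f {c} eq = begin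
    inv (length (concatMap g l)) * ∑ (concatMap g l) f     ≡⟨ cong₂ (λ a b → inv a * b) (length-concatMap g l eq) (∑-concatMap g l f) ⟩
    inv (length l ℕ.* c) * ∑ l (λ x → ∑ (g x) f)           ≡⟨ cong (_* ∑ l (λ x → ∑ (g x) f)) (inv-* (length l) c) ⟩
    inv (length l) * inv c * ∑ l (λ x → ∑ (g x) f)         ≡⟨ *-assoc (inv (length l)) (inv c) _ ⟩
    inv (length l) * (inv c * ∑ l (λ x → ∑ (g x) f))       ≡⟨ cong (λ y → inv (length l) * y) (sym (∑-* l (inv c) _)) ⟩
    inv (length l) * ∑ l (λ x → inv c * ∑ (g x) f)         ≡⟨ cong (λ y → inv (length l) * y) (∑-cong l (λ {x} x∈l → cong (λ a → inv a * ∑ (g x) f) (sym (eq x∈l)))) ⟩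
    mean l (λ x → mean (g x) f)                            ∎
    where open ≡-Reasoning

sumℚ-map : ∀ {A : Set} (l : List A) f → sumℚ (map f l) ≡ ∑ l f
sumℚ-map []      f = ≡.refl
sumℚ-map (x ∷ l) f = cong (λ y → f x + y) (sumℚ-map l f)

avg-map : ∀ {A : Set} (l : List A) f → avg (map f l) ≡ mean l f
avg-map []      f = ≡.refl
avg-map (x ∷ l) f = ≡.trans (*-comm (sumℚ (map f (x ∷ l))) (+ 1 / suc (length (map f l))))
  (cong₂ (λ a b → inv (suc a) * b) (length-map f l) (sumℚ-map (x ∷ l) f))

-- Arrival orders

0<! : ∀ n → 0 ℕ.< n !
0<! zero    = s≤s z≤n
0<! (suc n) = ℕₚ.*-mono-< {0} {suc n} (s≤s z≤n) (0<! n)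

module _ {A : Set} where

  -- Entries correspond to positions, so a uniform entry is a uniformly chosen item even when values
  -- repeat.
  sel : List A → List (A × List A)
  sel []       = []
  sel (x ∷ xs) = (x , xs) ∷ map (map₂ (x ∷_)) (sel xs)

  length-sel : ∀ xs → length (sel xs) ≡ length xs
  length-sel []       = ≡.refl
  length-sel (x ∷ xs) = cong suc (≡.trans (length-map _ (sel xs)) (length-sel xs))

  sel-↭ : ∀ xs {y r} → (y , r) ∈ sel xs → y ∷ r ↭ xs
  sel-↭ (x ∷ xs) (here ≡.refl) = ↭-refl
  sel-↭ (x ∷ xs) (there y∈) with ∈-map⁻ _ y∈
  ... | (y , r) , yr∈ , ≡.refl = trans (swap y x ↭-refl) (prep x (sel-↭ xs yr∈))

  ∑-sel : ∀ xs (f : A → ℚ) → ∑ (sel xs) (f ∘ proj₁) ≡ ∑ xs f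
  ∑-sel []       f = ≡.refl
  ∑-sel (x ∷ xs) f = cong (λ y → f x + y)
    (≡.trans (∑-map (map₂ (x ∷_)) (sel xs) (f ∘ proj₁)) (∑-sel xs f))

  mean-sel : ∀ xs (f : A → ℚ) → mean (sel xs) (f ∘ proj₁) ≡ mean xs f
  mean-sel xs f = cong₂ (λ a b → inv a * b) (length-sel xs) (∑-sel xs f)

  insertAll-↭ : ∀ x ys {p : List A} → p ∈ insertAll x ys → p ↭ x ∷ ys
  insertAll-↭ x []       (here ≡.refl) = ↭-refl
  insertAll-↭ x (y ∷ ys) (here ≡.refl) = ↭-refl
  insertAll-↭ x (y ∷ ys) (there p∈) with ∈-map⁻ _ p∈
  ... | q , q∈ , ≡.refl = trans (prep y (insertAll-↭ x ys q∈)) (swap y x ↭-refl)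

  perms-↭ : ∀ xs {p : List A} → p ∈ perms xs → p ↭ xs
  perms-↭ []       (here ≡.refl) = ↭-refl
  perms-↭ (x ∷ xs) p∈ with ∈-concatMap⁻ (insertAll x) {xs = perms xs} p∈
  ... | any = lemma any (perms-↭ xs)
    where
    lemma : ∀ {p l} → Any (λ q → p ∈ insertAll x q) l → (∀ {q} → q ∈ l → q ↭ xs) → p ↭ x ∷ xs
    lemma (here p∈) q↭  = trans (insertAll-↭ x _ p∈) (prep x (q↭ (here ≡.refl)))
    lemma (there a) q↭ = lemma a (q↭ ∘ there)

  length-insertAll : ∀ (x : A) ys → length (insertAll x ys) ≡ suc (length ys)
  length-insertAll x []       = ≡.refl
  length-insertAll x (y ∷ ys) = cong suc (≡.trans (length-map _ (insertAll x ys)) (length-insertAll x ys))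

  length-perms : ∀ (xs : List A) → length (perms xs) ≡ length xs !
  length-perms []       = ≡.refl
  length-perms (x ∷ xs) = ≡.trans
    (length-concatMap (insertAll x) (perms xs) λ {p} p∈ →
      ≡.trans (length-insertAll x p) (cong suc (↭-length (perms-↭ xs p∈))))
    (≡.trans (cong (ℕ._* suc (length xs)) (length-perms xs)) (ℕₚ.*-comm (length xs !) (suc (length xs))))

  0<length-perms : ∀ (xs : List A) → 0 ℕ.< length (perms xs)
  0<length-perms xs = subst (0 ℕ.<_) (sym (length-perms xs)) (0<! (length xs))

  -- Either `x` lands before the final `z`, which stays last, or `x` itself becomes last.
  ∑-insertAll-∷ʳ : ∀ x p z (f : List A → ℚ) →
    ∑ (insertAll x (p ∷ʳ z)) f ≡ ∑ (insertAll x p) (f ∘ (_∷ʳ z)) + f ((p ∷ʳ z) ∷ʳ x)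
  ∑-insertAll-∷ʳ x []      z f = lemma (f (x ∷ z ∷ [])) (f (z ∷ x ∷ []))
    where
    lemma : ∀ a b → a + (b + 0ℚ) ≡ a + 0ℚ + b
    lemma = solve-∀ ℚ-ring
  ∑-insertAll-∷ʳ x (y ∷ p) z f = begin
    f (x ∷ y ∷ p ∷ʳ z) + ∑ (map (y ∷_) (insertAll x (p ∷ʳ z))) f
      ≡⟨ cong (λ a → f (x ∷ y ∷ p ∷ʳ z) + a) (∑-map (y ∷_) (insertAll x (p ∷ʳ z)) f) ⟩
    f (x ∷ y ∷ p ∷ʳ z) + ∑ (insertAll x (p ∷ʳ z)) (f ∘ (y ∷_))
      ≡⟨ cong (λ a → f (x ∷ y ∷ p ∷ʳ z) + a) (∑-insertAll-∷ʳ x p z (f ∘ (y ∷_))) ⟩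
    f (x ∷ y ∷ p ∷ʳ z) + (∑ (insertAll x p) (λ q → f (y ∷ q ∷ʳ z)) + f (y ∷ (p ∷ʳ z) ∷ʳ x))
      ≡⟨ +-assoc (f (x ∷ y ∷ p ∷ʳ z)) _ _ ⟨
    f (x ∷ y ∷ p ∷ʳ z) + ∑ (insertAll x p) (λ q → f (y ∷ q ∷ʳ z)) + f (y ∷ (p ∷ʳ z) ∷ʳ x)
      ≡⟨ cong (λ a → f (x ∷ y ∷ p ∷ʳ z) + a + f (y ∷ (p ∷ʳ z) ∷ʳ x)) (∑-map (y ∷_) (insertAll x p) (f ∘ (_∷ʳ z))) ⟨
    f (x ∷ y ∷ p ∷ʳ z) + ∑ (map (y ∷_) (insertAll x p)) (f ∘ (_∷ʳ z)) + f (y ∷ (p ∷ʳ z) ∷ʳ x) ∎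
    where open ≡-Reasoning

  splitLast : (List A → ℚ) → A × List A → ℚ
  splitLast f (y , r) = ∑ (perms r) (λ p → f (p ∷ʳ y))

  ∑-perms-step : ∀ x l f → (∀ g → ∑ (perms l) g ≡ ∑ (sel l) (splitLast g)) →
    ∑ (perms (x ∷ l)) f ≡ ∑ (sel (x ∷ l)) (splitLast f)
  ∑-perms-step x l f ih = begin
    ∑ (concatMap (insertAll x) (perms l)) f
      ≡⟨ ∑-concatMap (insertAll x) (perms l) f ⟩
    ∑ (perms l) (λ p → ∑ (insertAll x p) f)
      ≡⟨ ih _ ⟩
    ∑ (sel l) (splitLast (λ p → ∑ (insertAll x p) f))
      ≡⟨ ∑-cong (sel l) (λ {zr} _ → inner zr) ⟩
    ∑ (sel l) (λ zr → before zr + after zr)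
      ≡⟨ ∑-+ (sel l) before after ⟩
    ∑ (sel l) before + ∑ (sel l) after
      ≡⟨ cong₂ _+_ (sym (∑-map (map₂ (x ∷_)) (sel l) (splitLast f))) (sym (ih (f ∘ (_∷ʳ x)))) ⟩
    ∑ (map (map₂ (x ∷_)) (sel l)) (splitLast f) + ∑ (perms l) (f ∘ (_∷ʳ x))
      ≡⟨ +-comm _ (∑ (perms l) (f ∘ (_∷ʳ x))) ⟩
    ∑ (sel (x ∷ l)) (splitLast f) ∎
    where
    open ≡-Reasoning
    before after : A × List A → ℚ
    before zr = splitLast f (map₂ (x ∷_) zr)
    after     = splitLast (f ∘ (_∷ʳ x))
    inner : ∀ zr → splitLast (λ p → ∑ (insertAll x p) f) zr ≡ before zr + after zr
    inner (z , r) = begin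
      ∑ (perms r) (λ p → ∑ (insertAll x (p ∷ʳ z)) f)
        ≡⟨ ∑-cong (perms r) (λ {p} _ → ∑-insertAll-∷ʳ x p z f) ⟩
      ∑ (perms r) (λ p → ∑ (insertAll x p) (f ∘ (_∷ʳ z)) + f ((p ∷ʳ z) ∷ʳ x))
        ≡⟨ ∑-+ (perms r) (λ p → ∑ (insertAll x p) (f ∘ (_∷ʳ z))) (λ p → f ((p ∷ʳ z) ∷ʳ x)) ⟩
      ∑ (perms r) (λ p → ∑ (insertAll x p) (f ∘ (_∷ʳ z))) + after (z , r)
        ≡⟨ cong (_+ after (z , r)) (sym (∑-concatMap (insertAll x) (perms r) (f ∘ (_∷ʳ z)))) ⟩
      before (z , r) + after (z , r) ∎

  -- `perms` grows by inserting the head of the list, whereas the analysis conditions on the last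
  -- arrival; this converts one view into the other. The induction starts at a singleton because the
  -- identity fails for `[]`: `perms []` has one element and `sel []` has none.
  ∑-perms : ∀ x xs f → ∑ (perms (x ∷ xs)) f ≡ ∑ (sel (x ∷ xs)) (splitLast f)
  ∑-perms x []        f = sym (+-identityʳ (f (x ∷ []) + 0ℚ))
  ∑-perms x (x′ ∷ xs) f = ∑-perms-step x (x′ ∷ xs) f (∑-perms x′ xs)

  mean-perms : ∀ x xs (f : List A → ℚ) →
    mean (perms (x ∷ xs)) f ≡ mean (sel (x ∷ xs)) (λ (y , r) → mean (perms r) (λ p → f (p ∷ʳ y)))
  mean-perms x xs f = begin
    inv (length (perms l)) * ∑ (perms l) f
      ≡⟨ cong₂ (λ a b → inv a * b) (length-perms l) (∑-perms x xs f) ⟩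
    inv (length l ℕ.* length xs !) * ∑ (sel l) g
      ≡⟨ cong (_* ∑ (sel l) g) (inv-* (length l) (length xs !)) ⟩
    inv (length l) * c * ∑ (sel l) g
      ≡⟨ *-assoc (inv (length l)) c _ ⟩
    inv (length l) * (c * ∑ (sel l) g)
      ≡⟨ cong₂ (λ a b → inv a * b) (length-sel l) (∑-* (sel l) c g) ⟨
    mean (sel l) (λ yr → c * g yr)
      ≡⟨ mean-cong (sel l) (λ {yr} yr∈ → cong (λ a → inv a * g yr)
           (sym (≡.trans (length-perms (proj₂ yr)) (cong _! (ℕₚ.suc-injective (↭-length (sel-↭ l yr∈))))))) ⟩
    mean (sel l) (λ (y , r) → mean (perms r) (λ p → f (p ∷ʳ y))) ∎
    where
    open ≡-Reasoning
    l = x ∷ xs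
    c = inv (length xs !)
    g = splitLast f

-- Counting

bit : Bool → ℕ
bit true  = 1
bit false = 0

ind : Bool → ℚ
ind = ι ∘ bit

total : {A : Set} → (A → ℕ) → List A → ℕ
total f []      = 0
total f (x ∷ l) = f x ℕ.+ total f l

module _ {A : Set} where

  total-+ : ∀ (f g : A → ℕ) l → total f l ℕ.+ total g l ≡ total (λ x → f x ℕ.+ g x) l
  total-+ f g []      = ≡.refl
  total-+ f g (x ∷ l) = ≡.trans (lemma (f x) (total f l) (g x) (total g l)) (cong (f x ℕ.+ g x ℕ.+_) (total-+ f g l))
    where
    lemma : ∀ a b c d → a ℕ.+ b ℕ.+ (c ℕ.+ d) ≡ a ℕ.+ c ℕ.+ (b ℕ.+ d)
    lemma = solveℕ-∀

  total-mono : ∀ (l : List A) {f g} → (∀ {x} → x ∈ l → f x ℕ.≤ g x) → total f l ℕ.≤ total g l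
  total-mono []      le = z≤n
  total-mono (x ∷ l) le = ℕₚ.+-mono-≤ (le (here ≡.refl)) (total-mono l (le ∘ there))

  total-const : ∀ (l : List A) → total (λ _ → 1) l ≡ length l
  total-const []      = ≡.refl
  total-const (x ∷ l) = cong suc (total-const l)

  total-∈ : ∀ {l : List A} {f x} → x ∈ l → f x ℕ.≤ total f l
  total-∈ (here ≡.refl) = ℕₚ.m≤m+n _ _
  total-∈ {y ∷ _} {f} (there x∈) = ℕₚ.≤-trans (total-∈ x∈) (ℕₚ.m≤n+m _ (f y))

  total-↭ : ∀ (f : A → ℕ) {l m} → l ↭ m → total f l ≡ total f m
  total-↭ f refl         = ≡.refl
  total-↭ f (prep x p)   = cong (f x ℕ.+_) (total-↭ f p)
  total-↭ f (swap {l} {m} x y p) = ≡.trans (cong (λ z → f x ℕ.+ (f y ℕ.+ z)) (total-↭ f p)) (lemma (f x) (f y) (total f m))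
    where
    lemma : ∀ a b c → a ℕ.+ (b ℕ.+ c) ≡ b ℕ.+ (a ℕ.+ c)
    lemma = solveℕ-∀
  total-↭ f (trans p q)  = ≡.trans (total-↭ f p) (total-↭ f q)

  ι-total : ∀ (f : A → ℕ) l → ι (total f l) ≡ ∑ l (ι ∘ f)
  ι-total f []      = ≡.refl
  ι-total f (x ∷ l) = ≡.trans (ι-+ (f x) (total f l)) (cong (λ y → ι (f x) + y) (ι-total f l))

exceeds equals : ℚ → ℚ → ℕ
exceeds θ x = bit (does (θ <? x))
equals  θ x = bit (does (θ ≟ x))

above equal : ℚ → List ℚ → ℕ
above θ = total (exceeds θ)
equal θ = total (equals θ)

exceeds-< : ∀ {θ x} → θ < x → exceeds θ x ≡ 1
exceeds-< {θ} {x} θ<x = cong bit (dec-true (θ <? x) θ<x)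

exceeds-≮ : ∀ {θ x} → ¬ θ < x → exceeds θ x ≡ 0
exceeds-≮ {θ} {x} θ≮x = cong bit (dec-false (θ <? x) θ≮x)

equals-≡ : ∀ {θ} → equals θ θ ≡ 1
equals-≡ {θ} = cong bit (dec-true (θ ≟ θ) ≡.refl)

equals-≢ : ∀ {θ x} → ¬ θ ≡ x → equals θ x ≡ 0
equals-≢ {θ} {x} θ≢x = cong bit (dec-false (θ ≟ x) θ≢x)

atLeast-≤ : ∀ {θ x} → θ ≤ x → exceeds θ x ℕ.+ equals θ x ≡ 1
atLeast-≤ {θ} {x} θ≤x with <-cmp θ x
... | tri< θ<x θ≢x _    = cong₂ ℕ._+_ (exceeds-< {θ} {x} θ<x) (equals-≢ {θ} {x} θ≢x)
... | tri≈ θ≮x ≡.refl _ = cong₂ ℕ._+_ (exceeds-≮ {θ} {θ} θ≮x) (equals-≡ {θ})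
... | tri> _ _ x<θ      = ⊥-elim (<-irrefl ≡.refl (≤-<-trans θ≤x x<θ))

atLeast-> : ∀ {θ x} → x < θ → exceeds θ x ℕ.+ equals θ x ≡ 0
atLeast-> {θ} {x} x<θ = cong₂ ℕ._+_ (exceeds-≮ {θ} {x} (<-asym x<θ)) (equals-≢ {θ} {x} (λ { ≡.refl → <-irrefl ≡.refl x<θ }))

above+equal≤above : ∀ {θ y} l → θ < y → above y l ℕ.+ equal y l ℕ.≤ above θ l
above+equal≤above {θ} {y} l θ<y =
  ℕₚ.≤-trans (ℕₚ.≤-reflexive (total-+ (exceeds y) (equals y) l)) (total-mono l (λ {x} _ → pointwise x))
  where
  pointwise : ∀ x → exceeds y x ℕ.+ equals y x ℕ.≤ exceeds θ x
  pointwise x with <-cmp x y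
  ... | tri< x<y _ _ = subst (ℕ._≤ exceeds θ x) (sym (atLeast-> {y} {x} x<y)) z≤n
  ... | tri≈ _ ≡.refl _ = ℕₚ.≤-reflexive (≡.trans (atLeast-≤ {y} {y} ≤-refl) (sym (exceeds-< {θ} {y} θ<y)))
  ... | tri> _ _ y<x = ℕₚ.≤-reflexive (≡.trans (atLeast-≤ {y} {x} (<⇒≤ y<x)) (sym (exceeds-< {θ} {x} (<-trans θ<y y<x))))

leastAbove : ∀ θ l → (∀ {x} → x ∈ l → ¬ θ < x) ⊎
  ∃ λ θ′ → θ′ ∈ l × θ < θ′ × (∀ {x} → x ∈ l → θ < x → θ′ ≤ x)
leastAbove θ []      = inj₁ λ ()
leastAbove θ (y ∷ l) with θ <? y | leastAbove θ l
... | no θ≮y | inj₁ none = inj₁ λ { (here ≡.refl) → θ≮y ; (there x∈) → none x∈ }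
... | no θ≮y | inj₂ (θ′ , θ′∈ , θ<θ′ , least) = inj₂ (θ′ , there θ′∈ , θ<θ′ ,
        λ { (here ≡.refl) θ<y → ⊥-elim (θ≮y θ<y) ; (there x∈) → least x∈ })
... | yes θ<y | inj₁ none = inj₂ (y , here ≡.refl , θ<y ,
        λ { (here ≡.refl) _ → ≤-refl ; (there x∈) θ<x → ⊥-elim (none x∈ θ<x) })
... | yes θ<y | inj₂ (θ′ , θ′∈ , θ<θ′ , least) with ≤-total y θ′
...   | inj₁ y≤θ′ = inj₂ (y , here ≡.refl , θ<y ,
          λ { (here ≡.refl) _ → ≤-refl ; (there x∈) θ<x → ≤-trans y≤θ′ (least x∈ θ<x) })
...   | inj₂ θ′≤y = inj₂ (θ′ , there θ′∈ , θ<θ′ ,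
          λ { (here ≡.refl) _ → θ′≤y ; (there x∈) → least x∈ })

-- Quantiles, the future dual prices

record Quantile (n M : ℕ) (l : List ℚ) : Set where
  field
    θ     : ℚ
    0≤θ   : 0ℚ ≤ θ
    θ≤1   : θ ≤ 1ℚ
    lower : n ℕ.* above θ l ℕ.≤ M
    upper : M ℕ.≤ n ℕ.* (above θ l ℕ.+ equal θ l)

-- The search climbs through the values occurring in `l`, keeping `upper` invariant. It starts at 0,
-- where `upper` holds because every item is nonnegative and so counts. Each move lowers `above θ l`
-- strictly, which bounds the number of moves.
quantile : ∀ n M l → All InUnit l → M ℕ.≤ n ℕ.* length l → Quantile n M l
quantile n M l l∈ M≤ = search (above 0ℚ l) 0ℚ ≤-refl 0≤1 ℕₚ.≤-refl (subst (λ c → M ℕ.≤ n ℕ.* c) (sym all≥0) M≤)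
  where
  all≥0 : above 0ℚ l ℕ.+ equal 0ℚ l ≡ length l
  all≥0 = ≡.trans (total-+ (exceeds 0ℚ) (equals 0ℚ) l) (≡.trans (lemma l∈) (total-const l))
    where
    lemma : ∀ {l} → All InUnit l → total (λ x → exceeds 0ℚ x ℕ.+ equals 0ℚ x) l ≡ total (λ _ → 1) l
    lemma []              = ≡.refl
    lemma {x ∷ _} ((0≤x , _) ∷ p) = cong₂ ℕ._+_ (atLeast-≤ {0ℚ} {x} 0≤x) (lemma p)
  search : ∀ fuel θ → 0ℚ ≤ θ → θ ≤ 1ℚ → above θ l ℕ.≤ fuel →
           M ℕ.≤ n ℕ.* (above θ l ℕ.+ equal θ l) → Quantile n M l
  search fuel θ 0≤θ θ≤1 ≤fuel upper with n ℕ.* above θ l ℕ.≤? M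
  ... | yes lower = record { θ = θ ; 0≤θ = 0≤θ ; θ≤1 = θ≤1 ; lower = lower ; upper = upper }
  ... | no ¬lower with leastAbove θ l
  ...   | inj₁ none = ⊥-elim (¬lower (subst (ℕ._≤ M) (sym (≡.trans (cong (n ℕ.*_) none′) (ℕₚ.*-zeroʳ n))) z≤n))
    where
    none′ : above θ l ≡ 0
    none′ = ℕₚ.n≤0⇒n≡0 (ℕₚ.≤-trans (total-mono l {g = λ _ → 0} (λ x∈ → ℕₚ.≤-reflexive (exceeds-≮ {θ} (none x∈)))) (ℕₚ.≤-reflexive (zeros l)))
      where
      zeros : ∀ (l : List ℚ) → total (λ _ → 0) l ≡ 0
      zeros []      = ≡.refl
      zeros (_ ∷ l) = zeros l
  ...   | inj₂ (θ′ , θ′∈ , θ<θ′ , least) = continue fuel ≤fuel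
    where
    decrease : suc (above θ′ l) ℕ.≤ above θ l
    decrease = ℕₚ.≤-trans
      (ℕₚ.≤-trans (ℕₚ.≤-reflexive (ℕₚ.+-comm 1 (above θ′ l)))
        (ℕₚ.+-monoʳ-≤ (above θ′ l) (ℕₚ.≤-trans (ℕₚ.≤-reflexive (sym (equals-≡ {θ′}))) (total-∈ {f = equals θ′} θ′∈))))
      (above+equal≤above l θ<θ′)
    -- No item lies strictly between `θ` and `θ′`. Hence the failure of `lower` at `θ` supplies
    -- `upper` at `θ′`.
    cover : above θ l ℕ.≤ above θ′ l ℕ.+ equal θ′ l
    cover = ℕₚ.≤-trans (total-mono l pointwise) (ℕₚ.≤-reflexive (sym (total-+ (exceeds θ′) (equals θ′) l)))
      where
      pointwise : ∀ {x} → x ∈ l → exceeds θ x ℕ.≤ exceeds θ′ x ℕ.+ equals θ′ x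
      pointwise {x} x∈ with θ <? x
      ... | no θ≮x  = subst (ℕ._≤ exceeds θ′ x ℕ.+ equals θ′ x) (sym (exceeds-≮ {θ} {x} θ≮x)) z≤n
      ... | yes θ<x = ℕₚ.≤-reflexive (≡.trans (exceeds-< {θ} {x} θ<x) (sym (atLeast-≤ {θ′} {x} (least x∈ θ<x))))
    continue : ∀ fuel → above θ l ℕ.≤ fuel → Quantile n M l
    continue zero       ≤0 = ⊥-elim (ℕₚ.n≮0 (ℕₚ.≤-trans decrease ≤0))
    continue (suc fuel) ≤s = search fuel θ′ (≤-trans 0≤θ (<⇒≤ θ<θ′)) (proj₂ (All.lookup l∈ θ′∈))
      (ℕₚ.≤-pred (ℕₚ.≤-trans decrease ≤s))
      (ℕₚ.≤-trans (ℕₚ.<⇒≤ (ℕₚ.≰⇒> ¬lower)) (ℕₚ.*-monoʳ-≤ n cover))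

-- The selection rule

-- A tie class of size `e ≤ n` leads to acceptance probabilities with denominator `n · e`. The
-- factor `n !` is divisible by every such `e`, so one seed range realises all of these
-- probabilities exactly.
seeds : ℕ → ℕ
seeds n = n ℕ.* n !

-- u / seeds n < (κt/n − a) / e for t = length l, a = above x l and e = equal x l, without denominators
accept : (n κ u : ℕ) → List ℚ → ℚ → Bool
accept n κ u l x =
  u ℕ.* (n ℕ.* equal x l) ℕ.+ seeds n ℕ.* (n ℕ.* above x l) ℕ.<ᵇ κ ℕ.* length l ℕ.* seeds n

-- This invariance decouples the decision at a step from the order of the earlier arrivals.
accept-↭ : ∀ n κ u x {l m} → l ↭ m → accept n κ u l x ≡ accept n κ u m x
accept-↭ n κ u x p = cong₂ ℕ._<ᵇ_
  (cong₂ (λ e a → u ℕ.* (n ℕ.* e) ℕ.+ seeds n ℕ.* (n ℕ.* a)) (total-↭ (equals x) p) (total-↭ (exceeds x) p))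
  (cong (λ t → κ ℕ.* t ℕ.* seeds n) (↭-length p))

quota : (n κ : ℕ) → List ℚ → ℚ → ℚ
quota n κ l x = mean (downFrom (seeds n)) (λ u → ind (accept n κ u l x))

<ᵇ-true : ∀ {m n} → m ℕ.< n → (m ℕ.<ᵇ n) ≡ true
<ᵇ-true {m} {n} m<n = dec-true (m ℕ.<? n) m<n

<ᵇ-false : ∀ {m n} → n ℕ.≤ m → (m ℕ.<ᵇ n) ≡ false
<ᵇ-false {m} {n} n≤m = dec-false (m ℕ.<? n) (ℕₚ.≤⇒≯ n≤m)

<ᵇ-cong : ∀ {m n m′ n′} → (m ℕ.< n → m′ ℕ.< n′) → (m′ ℕ.< n′ → m ℕ.< n) → (m ℕ.<ᵇ n) ≡ (m′ ℕ.<ᵇ n′)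
<ᵇ-cong {m} {n} to from with m ℕ.<? n
... | yes m<n = ≡.trans (<ᵇ-true m<n) (sym (<ᵇ-true (to m<n)))
... | no  m≮n = ≡.trans (<ᵇ-false (ℕₚ.≮⇒≥ m≮n)) (sym (<ᵇ-false (ℕₚ.≮⇒≥ (m≮n ∘ from))))

∑-downFrom-< : ∀ j N → j ℕ.≤ N → ∑ (downFrom N) (λ u → ind (u ℕ.<ᵇ j)) ≡ ι j
∑-downFrom-< zero    zero    _ = ≡.refl
∑-downFrom-< j       (suc N) j≤ with ℕₚ.m≤n⇒m<n∨m≡n j≤
... | inj₁ (s≤s j≤N) = ≡.trans (cong₂ _+_ (cong ind (<ᵇ-false j≤N)) (∑-downFrom-< j N j≤N)) (+-identityˡ (ι j))
... | inj₂ ≡.refl    = cong₂ _+_ (cong ind (<ᵇ-true (ℕₚ.n<1+n N))) (≡.trans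
        (∑-cong (downFrom N) (λ u∈ → cong ind (≡.trans (<ᵇ-true (ℕₚ.m<n⇒m<1+n (∈-downFrom⁻ u∈))) (sym (<ᵇ-true (∈-downFrom⁻ u∈))))))
        (∑-downFrom-< N N ℕₚ.≤-refl))

0<seeds : ∀ n → 0 ℕ.< seeds (suc n)
0<seeds n = ℕₚ.*-mono-< {0} {suc n} (s≤s z≤n) (0<! (suc n))

0<length-seeds : ∀ n → 0 ℕ.< length (downFrom (seeds (suc n)))
0<length-seeds n = subst (0 ℕ.<_) (sym (length-downFrom (seeds (suc n)))) (0<seeds n)

module _ (n-1 κ : ℕ) (l : List ℚ) where
  private
    n N M : ℕ
    n = suc n-1
    N = seeds n
    M = κ ℕ.* length l

  quota-full : ∀ {x} → 0 ℕ.< equal x l → n ℕ.* (above x l ℕ.+ equal x l) ℕ.≤ M → quota n κ l x ≡ 1ℚ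
  quota-full {x} 0<e ≤M = ≡.trans
    (mean-cong (downFrom N) (λ u∈ → cong ind (<ᵇ-true (small (∈-downFrom⁻ u∈)))))
    (mean-const (downFrom N) 1ℚ (0<length-seeds n-1))
    where
    e = equal x l
    a = above x l
    lemma : ∀ N n e a → N ℕ.* (n ℕ.* e) ℕ.+ N ℕ.* (n ℕ.* a) ≡ n ℕ.* (a ℕ.+ e) ℕ.* N
    lemma = solveℕ-∀
    small : ∀ {u} → u ℕ.< N → u ℕ.* (n ℕ.* e) ℕ.+ N ℕ.* (n ℕ.* a) ℕ.< M ℕ.* N
    small u<N = ℕₚ.<-≤-trans
      (ℕₚ.+-monoˡ-< (N ℕ.* (n ℕ.* a)) (ℕₚ.*-monoˡ-< (n ℕ.* e) {{ℕ.>-nonZero (ℕₚ.*-mono-< {0} {n} (s≤s z≤n) 0<e)}} u<N))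
      (ℕₚ.≤-trans (ℕₚ.≤-reflexive (lemma N n e a)) (ℕₚ.*-monoˡ-≤ N ≤M))

  quota-empty : ∀ {x} → M ℕ.≤ n ℕ.* above x l → quota n κ l x ≡ 0ℚ
  quota-empty {x} M≤ = ≡.trans
    (mean-cong (downFrom N) (λ {u} _ → cong ind (<ᵇ-false (ℕₚ.≤-trans
      (ℕₚ.≤-trans (ℕₚ.*-monoˡ-≤ N M≤) (ℕₚ.≤-reflexive (ℕₚ.*-comm _ N)))
      (ℕₚ.m≤n+m _ (u ℕ.* (n ℕ.* equal x l)))))))
    (mean-const (downFrom N) 0ℚ (0<length-seeds n-1))

  -- The seed range is divisible by n·e, so u·n·e < c·N holds for exactly c·N/(n·e) seeds u.
  quota-partial : ∀ {x} → equal x l ℕ.≤ n → n ℕ.* above x l ℕ.≤ M → M ℕ.≤ n ℕ.* (above x l ℕ.+ equal x l) →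
    ι n * (ι (above x l) + quota n κ l x * ι (equal x l)) ≡ ι M
  quota-partial {x} = go (equal x l) ≡.refl
   where
   go : ∀ e → equal x l ≡ e → e ℕ.≤ n → n ℕ.* above x l ℕ.≤ M → M ℕ.≤ n ℕ.* (above x l ℕ.+ e) →
    ι n * (ι (above x l) + quota n κ l x * ι e) ≡ ι M
   -- Without items equal to `x` the quota is multiplied by 0, and the two bounds on `M` squeeze it
   -- to `n · a`.
   go zero e≡ e≤n na≤M M≤ = begin
    ι n * (ι a + quota n κ l x * 0ℚ)     ≡⟨ cong (λ y → ι n * (ι a + y)) (*-zeroʳ (quota n κ l x)) ⟩
    ι n * (ι a + 0ℚ)                     ≡⟨ cong (λ y → ι n * y) (+-identityʳ (ι a)) ⟩
    ι n * ι a                            ≡⟨ ι-* n a ⟨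
    ι (n ℕ.* a)                          ≡⟨ cong ι (ℕₚ.≤-antisym na≤M (subst (λ b → M ℕ.≤ n ℕ.* b) (ℕₚ.+-identityʳ a) M≤)) ⟩
    ι M                                  ∎
    where
    open ≡-Reasoning
    a = above x l
   go (suc e-1) e≡ e≤n na≤M M≤ with ∣-trans (m∣m*n {suc e-1} (e-1 !)) (m≤n⇒m!∣n! e≤n)
   ... | divides d n!≡ = begin
    ι n * (ι a + inv (length (downFrom N)) * ∑ (downFrom N) (λ u → ind (accept n κ u l x)) * ι e)
      ≡⟨ cong₂ (λ i s → ι n * (ι a + i * s * ι e)) inverse (∑-cong (downFrom N) (λ {u} _ → cong ind (accept≡ u))) ⟩
    ι n * (ι a + inv n * (inv d * inv e) * ∑ (downFrom N) (λ u → ind (u ℕ.<ᵇ c ℕ.* d)) * ι e)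
      ≡⟨ cong (λ s → ι n * (ι a + inv n * (inv d * inv e) * s * ι e)) (≡.trans (∑-downFrom-< (c ℕ.* d) N cd≤N) (ι-* c d)) ⟩
    ι n * (ι a + inv n * (inv d * inv e) * (ι c * ι d) * ι e)
      ≡⟨ rearrange (ι n) (ι a) (inv n) (inv d) (inv e) (ι c) (ι d) (ι e) ⟩
    ι n * ι a + (ι n * inv n) * (ι d * inv d) * (ι e * inv e) * ι c
      ≡⟨ cong (λ s → ι n * ι a + s * ι c) (cong₂ _*_ (cong₂ _*_ (ι*inv n-1) (ι*inv′ 0<d)) (ι*inv e-1)) ⟩
    ι n * ι a + 1ℚ * 1ℚ * 1ℚ * ι c
      ≡⟨ cong₂ _+_ (sym (ι-* n a)) (*-identityˡ (ι c)) ⟩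
    ι (n ℕ.* a) + ι c
      ≡⟨ ι-+ (n ℕ.* a) c ⟨
    ι (n ℕ.* a ℕ.+ c)
      ≡⟨ cong ι na+c≡M ⟩
    ι M ∎
    where
    open ≡-Reasoning
    a = above x l
    e = suc e-1
    c = M ℕ.∸ n ℕ.* a
    na+c≡M : n ℕ.* a ℕ.+ c ≡ M
    na+c≡M = ℕₚ.m+[n∸m]≡n na≤M
    N≡ : N ≡ n ℕ.* (d ℕ.* e)
    N≡ = cong (n ℕ.*_) n!≡
    0<d : 0 ℕ.< d
    0<d = ℕₚ.n≢0⇒n>0 (λ { ≡.refl → ℕₚ.<-irrefl (sym n!≡) (0<! n) })
    ι*inv′ : ∀ {d} → 0 ℕ.< d → ι d * inv d ≡ 1ℚ
    ι*inv′ {suc d} _ = ι*inv d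
    inverse : inv (length (downFrom N)) ≡ inv n * (inv d * inv e)
    inverse = ≡.trans (cong inv (≡.trans (length-downFrom N) N≡)) (≡.trans (inv-* n (d ℕ.* e)) (cong (λ y → inv n * y) (inv-* d e)))
    c≤ne : c ℕ.≤ n ℕ.* e
    c≤ne = ℕₚ.+-cancelˡ-≤ (n ℕ.* a) c (n ℕ.* e)
      (ℕₚ.≤-trans (ℕₚ.≤-reflexive na+c≡M) (ℕₚ.≤-trans M≤ (ℕₚ.≤-reflexive (ℕₚ.*-distribˡ-+ n a e))))
    cd≤N : c ℕ.* d ℕ.≤ N
    cd≤N = ℕₚ.≤-trans (ℕₚ.*-monoˡ-≤ d c≤ne) (ℕₚ.≤-reflexive (≡.trans (lemma n e d) (sym N≡)))
      where
      lemma : ∀ n e d → n ℕ.* e ℕ.* d ≡ n ℕ.* (d ℕ.* e)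
      lemma = solveℕ-∀
    right : M ℕ.* N ≡ N ℕ.* (n ℕ.* a) ℕ.+ c ℕ.* d ℕ.* (n ℕ.* e)
    right = ≡.trans (cong (ℕ._* N) (sym na+c≡M)) (≡.trans (ℕₚ.*-distribʳ-+ N (n ℕ.* a) c)
      (cong₂ ℕ._+_ (ℕₚ.*-comm (n ℕ.* a) N) (≡.trans (cong (c ℕ.*_) N≡) (lemma c n d e))))
      where
      lemma : ∀ c n d e → c ℕ.* (n ℕ.* (d ℕ.* e)) ≡ c ℕ.* d ℕ.* (n ℕ.* e)
      lemma = solveℕ-∀
    accept≡ : ∀ u → accept n κ u l x ≡ (u ℕ.<ᵇ c ℕ.* d)
    accept≡ u = ≡.trans
      (cong₂ ℕ._<ᵇ_ (≡.trans (cong (λ e → u ℕ.* (n ℕ.* e) ℕ.+ N ℕ.* (n ℕ.* a)) e≡) (ℕₚ.+-comm (u ℕ.* (n ℕ.* e)) _)) right)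
      (<ᵇ-cong
        (λ lt → ℕₚ.*-cancelʳ-< (n ℕ.* e) u (c ℕ.* d) (ℕₚ.+-cancelˡ-< (N ℕ.* (n ℕ.* a)) _ _ lt))
        (λ lt → ℕₚ.+-monoʳ-< (N ℕ.* (n ℕ.* a)) (ℕₚ.*-monoˡ-< (n ℕ.* e) lt)))
    rearrange : ∀ n a i j k c d e →
      n * (a + i * (j * k) * (c * d) * e) ≡ n * a + (n * i) * (d * j) * (e * k) * c
    rearrange = solve-∀ ℚ-ring

ind-nonneg : ∀ b → 0ℚ ≤ ind b
ind-nonneg b = ι-nonneg (bit b)

ind≤1 : ∀ b → ind b ≤ 1ℚ
ind≤1 true  = ≤-refl
ind≤1 false = 0≤1

quota-nonneg : ∀ n κ l x → 0ℚ ≤ quota n κ l x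
quota-nonneg n κ l x = *-nonneg (inv-nonneg (length (downFrom (seeds n)))) (∑-nonneg (downFrom (seeds n)) (λ {u} _ → ind-nonneg (accept n κ u l x)))

quota≤1 : ∀ n-1 κ l x → quota (suc n-1) κ l x ≤ 1ℚ
quota≤1 n-1 κ l x = ≤-trans
  (mean-mono (downFrom (seeds (suc n-1))) (λ {u} _ → ind≤1 (accept (suc n-1) κ u l x)))
  (≤-reflexive (mean-const (downFrom (seeds (suc n-1))) 1ℚ (0<length-seeds n-1)))

-- The quotas are an optimal fractional choice of κ·t/n among the t items of l; θ is
-- the optimal dual price.
record Priced (n κ : ℕ) (l : List ℚ) : Set where
  field
    θ       : ℚ
    0≤θ     : 0ℚ ≤ θ
    θ≤1     : θ ≤ 1ℚ
    ∑-quota : ∑ l (quota n κ l) ≡ ι κ * inv n * ι (length l)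
    optimal : ∀ {x w} → x ∈ l → 0ℚ ≤ w → w ≤ 1ℚ → w * (x - θ) ≤ quota n κ l x * (x - θ)

-- Complementary slackness at the quantile: the quota is 1 above `θ` and 0 below it, so only items
-- equal to `θ` are fractional, and their common quota fills the budget exactly.
priced : ∀ n-1 κ l → All InUnit l → κ ℕ.≤ suc n-1 → length l ℕ.≤ suc n-1 → Priced (suc n-1) κ l
priced n-1 κ l l∈ κ≤n l≤n = record
  { θ = θ ; 0≤θ = 0≤θ ; θ≤1 = θ≤1 ; ∑-quota = sum ; optimal = optimal }
  where
  n = suc n-1
  M = κ ℕ.* length l
  open Quantile (quantile n M l l∈ (ℕₚ.*-monoˡ-≤ (length l) κ≤n))
  equal≤n : equal θ l ℕ.≤ n
  equal≤n = ℕₚ.≤-trans (ℕₚ.≤-trans (total-mono l (λ {x} _ → bit≤1 (does (θ ≟ x)))) (ℕₚ.≤-reflexive (total-const l))) l≤n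
    where
    bit≤1 : ∀ b → bit b ℕ.≤ 1
    bit≤1 true  = ℕₚ.≤-refl
    bit≤1 false = z≤n
  full : ∀ {x} → x ∈ l → θ < x → quota n κ l x ≡ 1ℚ
  full {x} x∈ θ<x = quota-full n-1 κ l {x}
    (ℕₚ.≤-trans (ℕₚ.≤-reflexive (sym (equals-≡ {x}))) (total-∈ {f = equals x} x∈))
    (ℕₚ.≤-trans (ℕₚ.*-monoʳ-≤ n (above+equal≤above l θ<x)) lower)
  empty : ∀ {x} → x < θ → quota n κ l x ≡ 0ℚ
  empty {x} x<θ = quota-empty n-1 κ l {x}
    (ℕₚ.≤-trans upper (ℕₚ.*-monoʳ-≤ n (above+equal≤above l x<θ)))
  pointwise : ∀ {x} → x ∈ l → quota n κ l x ≡ ι (exceeds θ x) + quota n κ l θ * ι (equals θ x)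
  pointwise {x} x∈ with <-cmp θ x
  ... | tri< θ<x θ≢x _ = ≡.trans (full x∈ θ<x) (sym (≡.trans
          (cong₂ (λ a b → ι a + quota n κ l θ * ι b) (exceeds-< {θ} {x} θ<x) (equals-≢ {θ} {x} θ≢x))
          (cong (λ y → ι 1 + y) (*-zeroʳ (quota n κ l θ)))))
  ... | tri≈ θ≮θ ≡.refl _ = sym (≡.trans
          (cong₂ (λ a b → ι a + quota n κ l θ * ι b) (exceeds-≮ {θ} {θ} θ≮θ) (equals-≡ {θ}))
          (≡.trans (+-identityˡ _) (*-identityʳ (quota n κ l θ))))
  ... | tri> θ≮x θ≢x x<θ = ≡.trans (empty x<θ) (sym (≡.trans
          (cong₂ (λ a b → ι a + quota n κ l θ * ι b) (exceeds-≮ {θ} {x} θ≮x) (equals-≢ {θ} {x} θ≢x))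
          (cong (λ y → 0ℚ + y) (*-zeroʳ (quota n κ l θ)))))
  scaled : ι n * ∑ l (quota n κ l) ≡ ι M
  scaled = ≡.trans (cong (λ y → ι n * y) (begin
    ∑ l (quota n κ l)                                                       ≡⟨ ∑-cong l pointwise ⟩
    ∑ l (λ x → ι (exceeds θ x) + quota n κ l θ * ι (equals θ x))            ≡⟨ ∑-+ l _ _ ⟩
    ∑ l (ι ∘ exceeds θ) + ∑ l (λ x → quota n κ l θ * ι (equals θ x))        ≡⟨ cong₂ _+_ (sym (ι-total (exceeds θ) l)) (∑-* l (quota n κ l θ) (ι ∘ equals θ)) ⟩
    ι (above θ l) + quota n κ l θ * ∑ l (ι ∘ equals θ)                      ≡⟨ cong (λ y → ι (above θ l) + quota n κ l θ * y) (sym (ι-total (equals θ) l)) ⟩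
    ι (above θ l) + quota n κ l θ * ι (equal θ l)                           ∎))
    (quota-partial n-1 κ l {θ} equal≤n lower upper)
    where open ≡-Reasoning
  sum : ∑ l (quota n κ l) ≡ ι κ * inv n * ι (length l)
  sum = begin
    Q                                  ≡⟨ *-identityˡ Q ⟨
    1ℚ * Q                             ≡⟨ cong (_* Q) (ι*inv n-1) ⟨
    ι n * inv n * Q                    ≡⟨ lemma₁ (ι n) (inv n) Q ⟩
    inv n * (ι n * Q)                  ≡⟨ cong (λ y → inv n * y) (≡.trans scaled (ι-* κ (length l))) ⟩
    inv n * (ι κ * ι (length l))       ≡⟨ lemma₂ (inv n) (ι κ) (ι (length l)) ⟩
    ι κ * inv n * ι (length l)         ∎
    where
    open ≡-Reasoning
    Q = ∑ l (quota n κ l)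
    lemma₁ : ∀ a b c → a * b * c ≡ b * (a * c)
    lemma₁ = solve-∀ ℚ-ring
    lemma₂ : ∀ a b c → a * (b * c) ≡ b * a * c
    lemma₂ = solve-∀ ℚ-ring
  optimal : ∀ {x w} → x ∈ l → 0ℚ ≤ w → w ≤ 1ℚ → w * (x - θ) ≤ quota n κ l x * (x - θ)
  optimal {x} {w} x∈ 0≤w w≤1 with <-cmp θ x
  ... | tri< θ<x _ _ = subst (λ q → w * (x - θ) ≤ q * (x - θ)) (sym (full x∈ θ<x))
          (*-monoʳ-≤-nonNeg (x - θ) {{nonNegative (0≤y-x (<⇒≤ θ<x))}} w≤1)
  ... | tri≈ _ ≡.refl _ = ≤-reflexive (lemma w (quota n κ l θ) θ)
    where
    lemma : ∀ a b c → a * (c - c) ≡ b * (c - c)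
    lemma = solve-∀ ℚ-ring
  ... | tri> _ _ x<θ = subst (λ q → w * (x - θ) ≤ q * (x - θ)) (sym (empty x<θ))
          (≤-slack (w * (θ - x)) (lemma w x θ) (*-nonneg 0≤w (0≤y-x (<⇒≤ x<θ))))
    where
    lemma : ∀ w x θ → 0ℚ * (x - θ) ≡ w * (x - θ) + w * (θ - x)
    lemma = solve-∀ ℚ-ring

-- The algorithm

module Rules (n κ : ℕ) where

  -- Only the decision on histories of length `t` is overwritten. Inductively, `rules t` carries the
  -- intended decisions for histories shorter than `t`, and later patches leave them intact.
  patch : ℕ → ℕ → Decision → Decision
  patch t u d h x = if length h ℕ.≡ᵇ t then accept n κ u (h ∷ʳ x) x else d h x

  -- A uniform choice from this list makes the seeds of different arrivals independent.
  rules : ℕ → List Decision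
  rules zero    = [ (λ _ _ → false) ]
  rules (suc t) = concatMap (λ u → map (patch t u) (rules t)) (downFrom (seeds n))

patch-now : ∀ n κ u d h x → Rules.patch n κ (length h) u d h x ≡ accept n κ u (h ∷ʳ x) x
patch-now n κ u d h x = cong (λ b → if b then accept n κ u (h ∷ʳ x) x else d h x) (dec-true (length h ℕ.≟ length h) ≡.refl)

patch-before : ∀ n κ t u d h x → length h ℕ.< t → Rules.patch n κ t u d h x ≡ d h x
patch-before n κ t u d h x h<t = cong (λ b → if b then accept n κ u (h ∷ʳ x) x else d h x) (dec-false (length h ℕ.≟ t) (ℕₚ.<⇒≢ h<t))

-- The capacity is ignored here, which keeps the acceptances independent; overflow is charged
-- separately.
tally : (ℚ → ℚ) → Decision → List ℚ → List ℚ → ℚ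
tally g d h []       = 0ℚ
tally g d h (x ∷ xs) = ind (d h x) * g x + tally g d (h ∷ʳ x) xs

tally-∷ʳ : ∀ g d h ys y → tally g d h (ys ∷ʳ y) ≡ tally g d h ys + ind (d (h ++ ys) y) * g y
tally-∷ʳ g d h [] y = ≡.trans (+-comm (ind (d h y) * g y) 0ℚ) (cong (λ h → 0ℚ + ind (d h y) * g y) (sym (++-identityʳ h)))
tally-∷ʳ g d h (x ∷ ys) y = begin
  ind (d h x) * g x + tally g d (h ∷ʳ x) (ys ∷ʳ y)
    ≡⟨ cong (λ s → ind (d h x) * g x + s) (tally-∷ʳ g d (h ∷ʳ x) ys y) ⟩
  ind (d h x) * g x + (tally g d (h ∷ʳ x) ys + ind (d ((h ∷ʳ x) ++ ys) y) * g y)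
    ≡⟨ cong (λ h′ → ind (d h x) * g x + (tally g d (h ∷ʳ x) ys + ind (d h′ y) * g y)) (++-assoc h [ x ] ys) ⟩
  ind (d h x) * g x + (tally g d (h ∷ʳ x) ys + ind (d (h ++ x ∷ ys) y) * g y)
    ≡⟨ +-assoc (ind (d h x) * g x) _ _ ⟨
  tally g d h (x ∷ ys) + ind (d (h ++ x ∷ ys) y) * g y ∎
  where open ≡-Reasoning

tally-cong : ∀ g {d d′} h ys → (∀ h′ x → length h′ ℕ.< length h ℕ.+ length ys → d h′ x ≡ d′ h′ x) →
             tally g d h ys ≡ tally g d′ h ys
tally-cong g h []       eq = ≡.refl
tally-cong g h (x ∷ ys) eq = cong₂ (λ b s → ind b * g x + s)
  (eq h x (ℕₚ.m<m+n (length h) (s≤s z≤n)))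
  (tally-cong g (h ∷ʳ x) ys λ h′ x′ lt → eq h′ x′ (subst (length h′ ℕ.<_) shift lt))
  where
  shift : length (h ∷ʳ x) ℕ.+ length ys ≡ length h ℕ.+ suc (length ys)
  shift = ≡.trans (cong (ℕ._+ length ys) (length-++ h)) (ℕₚ.+-assoc (length h) 1 (length ys))

-- Expectations over decision rules and arrival orders

module Expectation (n-1 κ : ℕ) where

  private
    n : ℕ
    n = suc n-1
    U : List ℕ
    U = downFrom (seeds n)

  open Rules n κ public

  length-rules : ∀ t → length (rules (suc t)) ≡ length U ℕ.* length (rules t)
  length-rules t = length-concatMap (λ u → map (patch t u) (rules t)) U (λ {u} _ → length-map (patch t u) (rules t))

  0<length-rules : ∀ t → 0 ℕ.< length (rules t)
  0<length-rules zero    = s≤s z≤n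
  0<length-rules (suc t) = subst (0 ℕ.<_) (sym (length-rules t)) (ℕₚ.*-mono-< (0<length-seeds n-1) (0<length-rules t))

  mean-rules : ∀ t f → mean (rules (suc t)) f ≡ mean U (λ u → mean (rules t) (f ∘ patch t u))
  mean-rules t f = ≡.trans
    (mean-concatMap (λ u → map (patch t u) (rules t)) U f (λ {u} _ → length-map (patch t u) (rules t)))
    (mean-cong U (λ {u} _ → mean-map (patch t u) (rules t) f))

  𝔼 : ℕ → List ℚ → (Decision → List ℚ → ℚ) → ℚ
  𝔼 t l F = mean (rules t) (λ d → mean (perms l) (F d))

  𝔼-cong : ∀ t l {F G} → (∀ {d ys} → d ∈ rules t → ys ∈ perms l → F d ys ≡ G d ys) → 𝔼 t l F ≡ 𝔼 t l G
  𝔼-cong t l eq = mean-cong (rules t) (λ d∈ → mean-cong (perms l) (eq d∈))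

  𝔼-mono : ∀ t l {F G} → (∀ {d ys} → d ∈ rules t → ys ∈ perms l → F d ys ≤ G d ys) → 𝔼 t l F ≤ 𝔼 t l G
  𝔼-mono t l le = mean-mono (rules t) (λ d∈ → mean-mono (perms l) (le d∈))

  𝔼-+ : ∀ t l F G → 𝔼 t l (λ d ys → F d ys + G d ys) ≡ 𝔼 t l F + 𝔼 t l G
  𝔼-+ t l F G = ≡.trans (mean-cong (rules t) (λ {d} _ → mean-+ (perms l) (F d) (G d))) (mean-+ (rules t) _ _)

  𝔼-* : ∀ t l c F → 𝔼 t l (λ d ys → c * F d ys) ≡ c * 𝔼 t l F
  𝔼-* t l c F = ≡.trans (mean-cong (rules t) (λ {d} _ → mean-* (perms l) c (F d))) (mean-* (rules t) c _)

  𝔼-const : ∀ t l c → 𝔼 t l (λ _ _ → c) ≡ c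
  𝔼-const t l c = ≡.trans (mean-cong (rules t) (λ _ → mean-const (perms l) c (0<length-perms l)))
                          (mean-const (rules t) c (0<length-rules t))

  -- A function of a Boolean is affine in its indicator, so the fresh seed enters only through the
  -- acceptance probability.
  mean-accept : ∀ l y (H : Bool → ℚ) →
    mean U (λ u → H (accept n κ u l y)) ≡ quota n κ l y * (H true - H false) + H false
  mean-accept l y H = begin
    mean U (λ u → H (b u))                                                ≡⟨ mean-cong U (λ {u} _ → split (b u)) ⟩
    mean U (λ u → (H true - H false) * ind (b u) + H false)               ≡⟨ mean-+ U _ _ ⟩
    mean U (λ u → (H true - H false) * ind (b u)) + mean U (λ _ → H false) ≡⟨ cong₂ _+_ (mean-* U (H true - H false) (ind ∘ b)) (mean-const U (H false) (0<length-seeds n-1)) ⟩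
    (H true - H false) * quota n κ l y + H false                          ≡⟨ cong (_+ H false) (*-comm (H true - H false) (quota n κ l y)) ⟩
    quota n κ l y * (H true - H false) + H false                          ∎
    where
    open ≡-Reasoning
    b = λ u → accept n κ u l y
    lemma₁ : ∀ s t → s ≡ (s - t) * 1ℚ + t
    lemma₁ = solve-∀ ℚ-ring
    lemma₂ : ∀ s t → t ≡ (s - t) * 0ℚ + t
    lemma₂ = solve-∀ ℚ-ring
    split : ∀ b → H b ≡ (H true - H false) * ind b + H false
    split true  = lemma₁ (H true) (H false)
    split false = lemma₂ (H true) (H false)

  tally-patch : ∀ g t u d {p y l} → length p ≡ t → p ∷ʳ y ↭ l →
    tally g (patch t u d) [] (p ∷ʳ y) ≡ tally g d [] p + ind (accept n κ u l y) * g y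
  tally-patch g _ u d {p} {y} {l} ≡.refl p↭ = ≡.trans
    (tally-∷ʳ g (patch (length p) u d) [] p y)
    (cong₂ (λ s b → s + ind b * g y)
      (tally-cong g [] p (λ h x → patch-before n κ (length p) u d h x))
      (≡.trans (patch-now n κ u d p y) (accept-↭ n κ u y p↭)))

  -- The last arrival `y` is uniform in `x ∷ xs`; given `y`, the earlier arrivals are in uniform
  -- order on `r`, and the seed for `y` is independent of the earlier ones. A general `φ` covers
  -- both first moments (`φ` the identity) and the second moment of the count (`φ` the square).
  𝔼-step : ∀ (φ : ℚ → ℚ) g x xs →
    𝔼 (suc (length xs)) (x ∷ xs) (λ d ys → φ (tally g d [] ys)) ≡
    mean (sel (x ∷ xs)) (λ (y , r) →
      quota n κ (x ∷ xs) y * (𝔼 (length xs) r (λ d p → φ (tally g d [] p + g y)) - 𝔼 (length xs) r (λ d p → φ (tally g d [] p)))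
        + 𝔼 (length xs) r (λ d p → φ (tally g d [] p)))
  𝔼-step φ g x xs = begin
    mean (rules (suc t)) (λ d → mean (perms l) (F d))
      ≡⟨ mean-rules t (λ d → mean (perms l) (F d)) ⟩
    mean U (λ u → mean (rules t) (λ d → mean (perms l) (F (patch t u d))))
      ≡⟨ mean-cong U (λ {u} _ → mean-cong (rules t) (λ {d} _ → mean-perms x xs (F (patch t u d)))) ⟩
    mean U (λ u → mean (rules t) (λ d → mean (sel l) (λ yr → G u d yr)))
      ≡⟨ mean-cong U (λ {u} _ → mean-swap (rules t) (sel l) (G u)) ⟩
    mean U (λ u → mean (sel l) (λ yr → mean (rules t) (λ d → G u d yr)))
      ≡⟨ mean-swap U (sel l) (λ u yr → mean (rules t) (λ d → G u d yr)) ⟩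
    mean (sel l) (λ yr → mean U (λ u → mean (rules t) (λ d → G u d yr)))
      ≡⟨ mean-cong (sel l) (λ {yr} yr∈ → mean-cong U (λ {u} _ → mean-cong (rules t) (λ {d} _ → last yr yr∈ u d))) ⟩
    mean (sel l) (λ yr → mean U (λ u → H yr (accept n κ u l (proj₁ yr))))
      ≡⟨ mean-cong (sel l) (λ {yr} _ → mean-accept l (proj₁ yr) (H yr)) ⟩
    mean (sel l) (λ yr → quota n κ l (proj₁ yr) * (H yr true - H yr false) + H yr false)
      ≡⟨ mean-cong (sel l) (λ {yr} _ → cong₂ (λ a b → quota n κ l (proj₁ yr) * (a - b) + b) (yes-case yr) (no-case yr)) ⟩
    mean (sel l) (λ (y , r) → quota n κ l y * (𝔼 t r (λ d p → φ (tally g d [] p + g y)) - 𝔼 t r (λ d p → φ (tally g d [] p)))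
        + 𝔼 t r (λ d p → φ (tally g d [] p))) ∎
    where
    open ≡-Reasoning
    l = x ∷ xs
    t = length xs
    F : Decision → List ℚ → ℚ
    F d ys = φ (tally g d [] ys)
    G : ℕ → Decision → ℚ × List ℚ → ℚ
    G u d (y , r) = mean (perms r) (λ p → F (patch t u d) (p ∷ʳ y))
    H : ℚ × List ℚ → Bool → ℚ
    H (y , r) b = 𝔼 t r (λ d p → φ (tally g d [] p + ind b * g y))
    last : ∀ yr → yr ∈ sel l → ∀ u d → G u d yr ≡
      mean (perms (proj₂ yr)) (λ p → φ (tally g d [] p + ind (accept n κ u l (proj₁ yr)) * g (proj₁ yr)))
    last (y , r) yr∈ u d = mean-cong (perms r) λ {p} p∈ → cong φ (tally-patch g t u d
      (≡.trans (↭-length (perms-↭ r p∈)) (ℕₚ.suc-injective (↭-length (sel-↭ l yr∈))))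
      (trans (↭-sym (∷↭∷ʳ y p)) (trans (prep y (perms-↭ r p∈)) (sel-↭ l yr∈))))
    yes-case : ∀ yr → H yr true ≡ 𝔼 t (proj₂ yr) (λ d p → φ (tally g d [] p + g (proj₁ yr)))
    yes-case (y , r) = 𝔼-cong t r (λ {d} {p} _ _ → cong (λ z → φ (tally g d [] p + z)) (*-identityˡ (g y)))
    no-case : ∀ yr → H yr false ≡ 𝔼 t (proj₂ yr) (λ d p → φ (tally g d [] p))
    no-case (y , r) = 𝔼-cong t r (λ {d} {p} _ _ → cong φ (≡.trans (cong (λ z → tally g d [] p + z) (*-zeroˡ (g y))) (+-identityʳ _)))

  gain : (ℚ → ℚ) → ℕ → List ℚ → ℚ
  gain g t l = 𝔼 t l (λ d → tally g d [])

  gain-step : ∀ g x xs → gain g (suc (length xs)) (x ∷ xs) ≡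
    mean (sel (x ∷ xs)) (λ (y , r) → quota n κ (x ∷ xs) y * g y + gain g (length xs) r)
  gain-step g x xs = ≡.trans (𝔼-step (λ z → z) g x xs) (mean-cong (sel (x ∷ xs)) λ {(y , r)} _ →
    cong (λ z → quota n κ (x ∷ xs) y * z + gain g (length xs) r) (difference y r))
    where
    open ≡-Reasoning
    t = length xs
    lemma : ∀ a b → a + b - a ≡ b
    lemma = solve-∀ ℚ-ring
    difference : ∀ y r → 𝔼 t r (λ d p → tally g d [] p + g y) - gain g t r ≡ g y
    difference y r = begin
      𝔼 t r (λ d p → tally g d [] p + g y) - gain g t r             ≡⟨ cong (_- gain g t r) (𝔼-+ t r _ _) ⟩
      gain g t r + 𝔼 t r (λ d p → g y) - gain g t r                 ≡⟨ cong (λ z → gain g t r + z - gain g t r) (𝔼-const t r (g y)) ⟩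
      gain g t r + g y - gain g t r                                 ≡⟨ lemma (gain g t r) (g y) ⟩
      g y                                                           ∎

  one : ℚ → ℚ
  one _ = 1ℚ

  count : Decision → List ℚ → ℚ
  count d ys = tally one d [] ys

  count² : ℕ → List ℚ → ℚ
  count² t l = 𝔼 t l (λ d ys → count d ys * count d ys)

  count²-step : ∀ x xs → count² (suc (length xs)) (x ∷ xs) ≡
    mean (sel (x ∷ xs)) (λ (y , r) →
      quota n κ (x ∷ xs) y * (gain one (length xs) r + gain one (length xs) r + 1ℚ) + count² (length xs) r)
  count²-step x xs = ≡.trans (𝔼-step (λ z → z * z) one x xs) (mean-cong (sel (x ∷ xs)) λ {(y , r)} _ →
    cong (λ z → quota n κ (x ∷ xs) y * z + count² (length xs) r) (difference r))
    where
    open ≡-Reasoning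
    t = length xs
    expand : ∀ z → (z + 1ℚ) * (z + 1ℚ) ≡ z * z + (z + z + 1ℚ)
    expand = solve-∀ ℚ-ring
    lemma : ∀ a b → a + b - a ≡ b
    lemma = solve-∀ ℚ-ring
    difference : ∀ r → 𝔼 t r (λ d p → (count d p + 1ℚ) * (count d p + 1ℚ)) - count² t r ≡ gain one t r + gain one t r + 1ℚ
    difference r = begin
      𝔼 t r (λ d p → (count d p + 1ℚ) * (count d p + 1ℚ)) - count² t r
        ≡⟨ cong (_- count² t r) (𝔼-cong t r (λ {d} {p} _ _ → expand (count d p))) ⟩
      𝔼 t r (λ d p → count d p * count d p + (count d p + count d p + 1ℚ)) - count² t r
        ≡⟨ cong (_- count² t r) (𝔼-+ t r _ _) ⟩
      count² t r + 𝔼 t r (λ d p → count d p + count d p + 1ℚ) - count² t r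
        ≡⟨ lemma (count² t r) _ ⟩
      𝔼 t r (λ d p → count d p + count d p + 1ℚ)
        ≡⟨ 𝔼-+ t r _ _ ⟩
      𝔼 t r (λ d p → count d p + count d p) + 𝔼 t r (λ d p → 1ℚ)
        ≡⟨ cong₂ _+_ (𝔼-+ t r _ _) (𝔼-const t r 1ℚ) ⟩
      gain one t r + gain one t r + 1ℚ ∎

-- Majorising linear terms by quadratic ones

square-cancel-≤ : ∀ {z s} → 0ℚ ≤ s → z * z ≤ s * s → z ≤ s
square-cancel-≤ {z} {s} 0≤s z²≤s² with z ≤? s
... | yes z≤s = z≤s
... | no  z≰s = ⊥-elim (<-irrefl ≡.refl (<-≤-trans s²<z² z²≤s²))
  where
  s<z : s < z
  s<z = ≰⇒> z≰s
  s²<z² : s * s < z * z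
  s²<z² = ≤-<-trans (*-monoˡ 0≤s (<⇒≤ s<z)) (*-monoˡ-<-pos z {{positive (≤-<-trans 0≤s s<z)}} s<z)

¼ : ℚ
¼ = ½ * ½

-- (η z² + ρ)² ≥ 4 η ρ z² ≥ z²
linear≤quadratic : ∀ {η ρ} z → 0ℚ ≤ η → 0ℚ ≤ ρ → ¼ ≤ η * ρ → z ≤ η * (z * z) + ρ
linear≤quadratic {η} {ρ} z 0≤η 0≤ρ ¼≤ηρ = square-cancel-≤
  (+-nonneg (*-nonneg 0≤η (square-nonneg z)) 0≤ρ)
  (≤-slack ((η * (z * z) - ρ) * (η * (z * z) - ρ) + (1ℚ + 1ℚ + 1ℚ + 1ℚ) * (η * ρ - ¼) * (z * z)) (lemma η ρ z)
    (+-nonneg (square-nonneg (η * (z * z) - ρ))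
      (*-nonneg (*-nonneg (ι-nonneg 4) (0≤y-x ¼≤ηρ)) (square-nonneg z))))
  where
  lemma : ∀ η ρ z → (η * (z * z) + ρ) * (η * (z * z) + ρ) ≡
    z * z + ((η * (z * z) - ρ) * (η * (z * z) - ρ) + (1ℚ + 1ℚ + 1ℚ + 1ℚ) * (η * ρ - ½ * ½) * (z * z))
  lemma = solve-∀ ℚ-ring

-- Wallis products as substitutes for 1/√t

wallis : ℕ → ℚ
wallis zero    = 1ℚ
wallis (suc t) = wallis t * (1ℚ - ½ * inv (suc t))

inv≤1 : ∀ t → inv (suc t) ≤ 1ℚ
inv≤1 t = ≤-slack (ι t * inv (suc t)) (≡.trans (sym (ι*inv t)) (lemma (ι t) (inv (suc t))))
  (*-nonneg (ι-nonneg t) (inv-nonneg (suc t)))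
  where
  lemma : ∀ a b → (1ℚ + a) * b ≡ b + a * b
  lemma = solve-∀ ℚ-ring

0≤½ : 0ℚ ≤ ½
0≤½ = nonNegative⁻¹ ½

0≤1-½*inv : ∀ t → 0ℚ ≤ 1ℚ - ½ * inv (suc t)
0≤1-½*inv t = subst (0ℚ ≤_) (lemma (inv (suc t))) (+-nonneg (*-nonneg 0≤½ (0≤y-x (inv≤1 t))) 0≤½)
  where
  lemma : ∀ i → ½ * (1ℚ - i) + ½ ≡ 1ℚ - ½ * i
  lemma = solve-∀ ℚ-ring

wallis-nonneg : ∀ t → 0ℚ ≤ wallis t
wallis-nonneg zero    = 0≤1
wallis-nonneg (suc t) = *-nonneg (wallis-nonneg t) (0≤1-½*inv t)

-- The right side is nondecreasing, and 1/4 is its value at the first index.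
¼≤t*wallis² : ∀ t → ¼ ≤ ι (suc t) * (wallis (suc t) * wallis (suc t))
¼≤t*wallis² zero    = ≤-refl
¼≤t*wallis² (suc t) = ≤-trans (¼≤t*wallis² t) (≤-slack (¼ * i * (g * g)) step
  (*-nonneg (*-nonneg (*-nonneg 0≤½ 0≤½) (inv-nonneg (suc (suc t)))) (square-nonneg g)))
  where
  g = wallis (suc t)
  i = inv (suc (suc t))
  -- The ring solver treats `i` as a free variable. The multiple of `1ℚ - (1ℚ + τ) * i` records how
  -- the identity uses that `i` is a reciprocal, and it vanishes by `ι*inv`.
  lemma : ∀ τ i g → (1ℚ + τ) * (g * (1ℚ - ½ * i) * (g * (1ℚ - ½ * i))) ≡
    τ * (g * g) + ½ * ½ * i * (g * g) + (1ℚ - (1ℚ + τ) * i) * ((1ℚ - ½ * ½ * i) * (g * g))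
  lemma = solve-∀ ℚ-ring
  zero-out : ∀ a b → a + (1ℚ - 1ℚ) * b ≡ a
  zero-out = solve-∀ ℚ-ring
  step : ι (suc (suc t)) * (wallis (suc (suc t)) * wallis (suc (suc t))) ≡ ι (suc t) * (g * g) + ¼ * i * (g * g)
  step = ≡.trans (lemma (ι (suc t)) i g)
    (≡.trans (cong (λ e → ι (suc t) * (g * g) + ¼ * i * (g * g) + (1ℚ - e) * ((1ℚ - ¼ * i) * (g * g))) (ι*inv (suc t)))
      (zero-out (ι (suc t) * (g * g) + ¼ * i * (g * g)) ((1ℚ - ¼ * i) * (g * g))))

¼≤[1+t]*wallis² : ∀ t → ¼ ≤ ι (suc t) * (wallis t * wallis t)
¼≤[1+t]*wallis² zero    = *≤* (ℤ.+≤+ (s≤s z≤n))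
¼≤[1+t]*wallis² (suc t) = ≤-trans (¼≤t*wallis² t)
  (*-monoʳ-≤-nonNeg (wallis (suc t) * wallis (suc t)) {{nonNegative (square-nonneg (wallis (suc t)))}} (ι-mono (ℕₚ.n≤1+n (suc t))))

-- The left side is 1 at `t = 0` and nonincreasing. The summand 1 next to 2t makes this work: (2t +
-- 1)(2t + 3) ≤ (2t + 2)².
[1+2t]*wallis²≤1 : ∀ t → (ι t + ι t + 1ℚ) * (wallis t * wallis t) ≤ 1ℚ
[1+2t]*wallis²≤1 zero    = ≤-refl
[1+2t]*wallis²≤1 (suc t) = ≤-trans (≤-slack (½ * i * (1ℚ - ½ * i) * (g * g)) step
    (*-nonneg (*-nonneg (*-nonneg 0≤½ (inv-nonneg (suc t))) (0≤1-½*inv t)) (square-nonneg g)))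
  ([1+2t]*wallis²≤1 t)
  where
  g = wallis t
  i = inv (suc t)
  lemma : ∀ τ i g → (τ + τ + 1ℚ) * (g * g) ≡
    ((1ℚ + τ) + (1ℚ + τ) + 1ℚ) * (g * (1ℚ - ½ * i) * (g * (1ℚ - ½ * i))) + ½ * i * (1ℚ - ½ * i) * (g * g)
      - (1ℚ - (1ℚ + τ) * i) * ((1ℚ + 1ℚ - ½ * i) * (g * g))
  lemma = solve-∀ ℚ-ring
  zero-out : ∀ a b → a - (1ℚ - 1ℚ) * b ≡ a
  zero-out = solve-∀ ℚ-ring
  step : (ι t + ι t + 1ℚ) * (g * g) ≡
    (ι (suc t) + ι (suc t) + 1ℚ) * (wallis (suc t) * wallis (suc t)) + ½ * i * (1ℚ - ½ * i) * (g * g)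
  step = ≡.trans (lemma (ι t) i g)
    (≡.trans (cong (λ e → (ι (suc t) + ι (suc t) + 1ℚ) * (wallis (suc t) * wallis (suc t)) + ½ * i * (1ℚ - ½ * i) * (g * g)
        - (1ℚ - e) * ((1ℚ + 1ℚ - ½ * i) * (g * g))) (ι*inv t))
      (zero-out _ ((1ℚ + 1ℚ - ½ * i) * (g * g))))

t*wallis²≤½ : ∀ t → ι t * (wallis t * wallis t) ≤ ½
t*wallis²≤½ t = ≤-slack (½ * (1ℚ - (ι t + ι t + 1ℚ) * (g * g)) + ½ * (g * g)) (lemma (ι t) g)
  (+-nonneg (*-nonneg 0≤½ (0≤y-x ([1+2t]*wallis²≤1 t))) (*-nonneg 0≤½ (square-nonneg g)))
  where
  g = wallis t
  lemma : ∀ τ g → ½ ≡ τ * (g * g) + (½ * (1ℚ - (τ + τ + 1ℚ) * (g * g)) + ½ * (g * g))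
  lemma = solve-∀ ℚ-ring

-- Backward induction: moments of the count and the potential

sel-InUnit : ∀ {l y r} → (y , r) ∈ sel l → All InUnit l → All InUnit r
sel-InUnit {l} yr∈ l∈ = All.tail (All-resp-↭ (↭-sym (sel-↭ l yr∈)) l∈)

∑-rest : ∀ {l y r} → (y , r) ∈ sel l → ∀ (f : ℚ → ℚ) → ∑ r f ≡ ∑ l f - f y
∑-rest {l} {y} {r} yr∈ f = ≡.trans (lemma (∑ r f) (f y)) (cong (_- f y) (∑-↭ f (sel-↭ l yr∈)))
  where
  lemma : ∀ a b → a ≡ b + a - b
  lemma = solve-∀ ℚ-ring

∑-price : ∀ l θ (f : ℚ → ℚ) → ∑ l (λ x → f x * (x - θ)) ≡ ∑ l (λ x → f x * x) - θ * ∑ l f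
∑-price l θ f = begin
  ∑ l (λ x → f x * (x - θ))                          ≡⟨ ∑-cong l (λ {x} _ → lemma (f x) x θ) ⟩
  ∑ l (λ x → f x * x + - θ * f x)                    ≡⟨ ∑-+ l _ _ ⟩
  ∑ l (λ x → f x * x) + ∑ l (λ x → - θ * f x)        ≡⟨ cong (λ s → ∑ l (λ x → f x * x) + s) (≡.trans (∑-* l (- θ) f) (sym (neg-distribˡ-* θ (∑ l f)))) ⟩
  ∑ l (λ x → f x * x) - θ * ∑ l f                    ∎
  where
  open ≡-Reasoning
  lemma : ∀ a x θ → a * (x - θ) ≡ a * x + - θ * a
  lemma = solve-∀ ℚ-ring

module Analysis (n-1 κ : ℕ) (κ≤n : κ ℕ.≤ suc n-1) where

  open Expectation n-1 κ public

  n : ℕ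
  n = suc n-1

  p : ℚ
  p = ι κ * inv n

  Small : ℕ → List ℚ → Set
  Small t l = length l ≡ t × t ℕ.≤ n × All InUnit l

  small-sel : ∀ {x xs y r} → (y , r) ∈ sel (x ∷ xs) → Small (suc (length xs)) (x ∷ xs) → Small (length xs) r
  small-sel {x} {xs} yr∈ (_ , t≤n , l∈) =
    ℕₚ.suc-injective (↭-length (sel-↭ (x ∷ xs) yr∈)) , ℕₚ.≤-trans (ℕₚ.n≤1+n _) t≤n , sel-InUnit yr∈ l∈

  prices : ∀ {t l} → Small t l → Priced n κ l
  prices {l = l} (≡.refl , t≤n , l∈) = priced n-1 κ l l∈ κ≤n t≤n

  -- The quotas use up a budget proportional to the length of the list, so the last arrival is
  -- accepted with probability `p` whatever the set is. This is the source of independence.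
  mean-quota : ∀ {x xs} → Small (suc (length xs)) (x ∷ xs) → mean (sel (x ∷ xs)) (quota n κ (x ∷ xs) ∘ proj₁) ≡ p
  mean-quota {x} {xs} small = begin
    mean (sel l) (quota n κ l ∘ proj₁)                ≡⟨ mean-sel l (quota n κ l) ⟩
    inv (length l) * ∑ l (quota n κ l)                ≡⟨ cong (λ s → inv (length l) * s) (Priced.∑-quota (prices small)) ⟩
    inv (length l) * (p * ι (length l))               ≡⟨ lemma (inv (length l)) p (ι (length l)) ⟩
    p * (ι (length l) * inv (length l))               ≡⟨ cong (λ s → p * s) (ι*inv (length xs)) ⟩
    p * 1ℚ                                            ≡⟨ *-identityʳ p ⟩
    p                                                 ∎
    where
    open ≡-Reasoning
    l = x ∷ xs
    lemma : ∀ a b c → a * (b * c) ≡ b * (c * a)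
    lemma = solve-∀ ℚ-ring

  mean-quota-affine : ∀ {x xs} → Small (suc (length xs)) (x ∷ xs) → ∀ a b →
    mean (sel (x ∷ xs)) (λ yr → quota n κ (x ∷ xs) (proj₁ yr) * a + b) ≡ p * a + b
  mean-quota-affine {x} {xs} small a b = begin
    mean (sel l) (λ yr → q yr * a + b)              ≡⟨ mean-cong (sel l) (λ {yr} _ → cong (_+ b) (*-comm (q yr) a)) ⟩
    mean (sel l) (λ yr → a * q yr + b)              ≡⟨ mean-+ (sel l) (λ yr → a * q yr) (λ _ → b) ⟩
    mean (sel l) (λ yr → a * q yr) + mean (sel l) (λ _ → b) ≡⟨ cong₂ _+_ (mean-* (sel l) a q) (mean-const (sel l) b (s≤s z≤n)) ⟩
    a * mean (sel l) q + b                          ≡⟨ cong (λ s → a * s + b) (mean-quota small) ⟩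
    a * p + b                                       ≡⟨ cong (_+ b) (*-comm a p) ⟩
    p * a + b                                       ∎
    where
    open ≡-Reasoning
    l = x ∷ xs
    q = quota n κ l ∘ proj₁

  gain-one : ∀ t l → Small t l → gain one t l ≡ p * ι t
  gain-one zero    []       _ = sym (*-zeroʳ p)
  gain-one (suc t) (x ∷ xs) small@(≡.refl , _) = begin
    gain one (suc t) l                                                     ≡⟨ gain-step one x xs ⟩
    mean (sel l) (λ (y , r) → quota n κ l y * 1ℚ + gain one t r)           ≡⟨ mean-cong (sel l) (λ {(y , r)} yr∈ → cong (λ s → quota n κ l y * 1ℚ + s) (gain-one t r (small-sel yr∈ small))) ⟩
    mean (sel l) (λ yr → quota n κ l (proj₁ yr) * 1ℚ + p * ι t)            ≡⟨ mean-quota-affine small 1ℚ (p * ι t) ⟩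
    p * 1ℚ + p * ι t                                                       ≡⟨ *-distribˡ-+ p 1ℚ (ι t) ⟨
    p * ι (suc t)                                                          ∎
    where
    open ≡-Reasoning
    l = x ∷ xs

  -- Since `gain one` is the same for every remainder `r`, the cross term factors as for independent
  -- indicators. The exact variance is t p (1 - p); each step gives away `p * p` for a simpler
  -- bound.
  count²≤ : ∀ t l → Small t l → count² t l ≤ (p * ι t) * (p * ι t) + p * ι t
  count²≤ zero    []       _ = ≤-reflexive (lemma p)
    where
    lemma : ∀ p → 0ℚ ≡ (p * 0ℚ) * (p * 0ℚ) + p * 0ℚ
    lemma = solve-∀ ℚ-ring
  count²≤ (suc t) (x ∷ xs) small@(≡.refl , _) = begin
    count² (suc t) l
      ≡⟨ count²-step x xs ⟩
    mean (sel l) (λ (y , r) → quota n κ l y * (gain one t r + gain one t r + 1ℚ) + count² t r)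
      ≤⟨ mean-mono (sel l) (λ {(y , r)} yr∈ → +-mono-≤
           (≤-reflexive (cong (λ s → quota n κ l y * (s + s + 1ℚ)) (gain-one t r (small-sel yr∈ small))))
           (count²≤ t r (small-sel yr∈ small))) ⟩
    mean (sel l) (λ yr → quota n κ l (proj₁ yr) * (μ + μ + 1ℚ) + (μ * μ + μ))
      ≡⟨ mean-quota-affine small (μ + μ + 1ℚ) (μ * μ + μ) ⟩
    p * (μ + μ + 1ℚ) + (μ * μ + μ)
      ≤⟨ ≤-slack (p * p) (lemma p (ι t)) (square-nonneg p) ⟩
    (p * ι (suc t)) * (p * ι (suc t)) + p * ι (suc t) ∎
    where
    open ≤-Reasoning
    l = x ∷ xs
    μ = p * ι t
    lemma : ∀ p t → (p * (1ℚ + t)) * (p * (1ℚ + t)) + p * (1ℚ + t) ≡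
      p * (p * t + p * t + 1ℚ) + (p * t * (p * t) + p * t) + p * p
    lemma = solve-∀ ℚ-ring

  -- L and M stand for √(k/n) and √(n/k) up to constants.
  module Potential (w : ℚ → ℚ) (0≤w : ∀ x → 0ℚ ≤ w x) (w≤1 : ∀ x → w x ≤ 1ℚ)
                   (L M : ℚ) (0≤L : 0ℚ ≤ L) (0≤M : 0ℚ ≤ M) (1≤LM : 1ℚ ≤ L * M) where

    dev : ℚ → ℚ
    dev x = w x - p

    value drift spread : List ℚ → ℚ
    value  l = ∑ l (λ x → w x * x)
    drift  l = ∑ l dev
    spread l = ∑ l (λ x → dev x * dev x)

    -- Removing a uniform item from t + 1 items changes the mean of `drift`² from D² to D² - (2 D² -
    -- Z) / (t + 1), with Z the `spread`. The spread has to be carried along to pay for the term in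
    -- Z; the last term pays the constants left by the quadratic majorants.
    potential : ℕ → List ℚ → ℚ
    potential t l = value l - M * wallis t * (drift l * drift l)
      - (M * wallis t + M * wallis t) * spread l - (L + L) * ι t * wallis t

    -- Lagrangian comparison: `w` may use a different budget on `l` than the quotas do, and the
    -- optimal price `θ` converts the difference, which is the drift, into value. That cost is then
    -- majorised by a quadratic in the drift.
    quota-value : ∀ {t l} → Small (suc t) l →
      value l - (M * wallis t * (drift l * drift l) + L * ι (suc t) * wallis t) ≤ ∑ l (λ x → quota n κ l x * x)
    quota-value {t} {l} small = ≤-trans
      (+-monoʳ-≤ (value l) (neg-antimono-≤ price-of-drift))
      (≤-slack (∑ l (λ x → q x * (x - θ)) - ∑ l (λ x → w x * (x - θ))) exchange
        (0≤y-x (∑-mono l λ {x} x∈ → optimal x∈ (0≤w x) (w≤1 x))))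
      where
      open Priced (prices small)
      q = quota n κ l
      g = wallis t
      drift≡ : drift l ≡ ∑ l w - ∑ l q
      drift≡ = begin
        ∑ l (λ x → w x - p)                   ≡⟨ ∑-+ l w (λ _ → - p) ⟩
        ∑ l w + ∑ l (λ _ → - p)               ≡⟨ cong (λ s → ∑ l w + s) (∑-const l (- p)) ⟩
        ∑ l w + ι (length l) * - p            ≡⟨ lemma (∑ l w) (ι (length l)) p ⟩
        ∑ l w - p * ι (length l)              ≡⟨ cong (λ s → ∑ l w - s) ∑-quota ⟨
        ∑ l w - ∑ l q                         ∎
        where
        open ≡-Reasoning
        lemma : ∀ a b c → a + b * - c ≡ a - c * b
        lemma = solve-∀ ℚ-ring
      exchange : ∑ l (λ x → q x * x) ≡
        value l - θ * drift l + (∑ l (λ x → q x * (x - θ)) - ∑ l (λ x → w x * (x - θ)))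
      exchange = ≡.trans (lemma (∑ l (λ x → q x * x)) (value l) θ (∑ l w) (∑ l q))
        (cong₂ (λ D E → value l - θ * D + E) (sym drift≡) (cong₂ _-_ (sym (∑-price l θ q)) (sym (∑-price l θ w))))
        where
        lemma : ∀ V A θ W Q → V ≡ A - θ * (W - Q) + ((V - θ * Q) - (A - θ * W))
        lemma = solve-∀ ℚ-ring
      η*ρ : ¼ ≤ M * g * (L * ι (suc t) * g)
      η*ρ = ≤-trans (¼≤[1+t]*wallis² t) (≤-slack ((L * M - 1ℚ) * (ι (suc t) * (g * g))) (lemma M g L (ι (suc t)))
        (*-nonneg (0≤y-x 1≤LM) (*-nonneg (ι-nonneg (suc t)) (square-nonneg g))))
        where
        lemma : ∀ M g L τ → M * g * (L * τ * g) ≡ τ * (g * g) + (L * M - 1ℚ) * (τ * (g * g))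
        lemma = solve-∀ ℚ-ring
      -- Because `0 ≤ θ ≤ 1`, a negative drift costs nothing and a positive one at most itself.
      price-of-drift : θ * drift l ≤ M * g * (drift l * drift l) + L * ι (suc t) * g
      price-of-drift with ≤-total 0ℚ (drift l)
      ... | inj₁ 0≤D = ≤-trans (*-monoʳ-≤-nonNeg (drift l) {{nonNegative 0≤D}} θ≤1)
              (≤-trans (≤-reflexive (*-identityˡ (drift l)))
                (linear≤quadratic (drift l) (*-nonneg 0≤M (wallis-nonneg t))
                  (*-nonneg (*-nonneg 0≤L (ι-nonneg (suc t))) (wallis-nonneg t)) η*ρ))
      ... | inj₂ D≤0 = ≤-trans (≤-trans (*-monoˡ 0≤θ D≤0) (≤-reflexive (*-zeroʳ θ)))
              (+-nonneg (*-nonneg (*-nonneg 0≤M (wallis-nonneg t)) (square-nonneg (drift l)))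
                (*-nonneg (*-nonneg 0≤L (ι-nonneg (suc t))) (wallis-nonneg t)))

    -- Adding the value collected at the last step to the average potential of the remainder
    -- recovers at least the potential of the whole list.
    potential≤gain : ∀ t l → Small t l → potential t l ≤ gain id t l
    potential≤gain zero [] _ = ≤-reflexive (lemma M L)
      where
      lemma : ∀ M L → 0ℚ - M * 1ℚ * (0ℚ * 0ℚ) - (M * 1ℚ + M * 1ℚ) * 0ℚ - (L + L) * 0ℚ * 1ℚ ≡ 0ℚ
      lemma = solve-∀ ℚ-ring
    potential≤gain (suc t) (x ∷ xs) small@(≡.refl , _) = begin
      potential (suc t) l
        -- The factor `1 - ½ i` of `wallis` is chosen for this step. It balances the spread terms, 2
        -- (1 - i) + i = 2 (1 - ½ i), and the terms in `L`, 2 t + 1 = 2 (t + 1)(1 - ½ i), exactly.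
        -- The drift coefficient loses 2 i by averaging and regains i through the price, so ½ i of
        -- it is left over.
        ≤⟨ ≤-slack (i * (V - (A - (M * g * (D * D) + L * ι (suc t) * g))) + ½ * i * (M * g) * (D * D)) balance
             (+-nonneg (*-nonneg (inv-nonneg (suc t)) (0≤y-x (quota-value small)))
               (*-nonneg (*-nonneg (*-nonneg 0≤½ (inv-nonneg (suc t))) (*-nonneg 0≤M (wallis-nonneg t))) (square-nonneg D))) ⟩
      i * (ι (suc t) * c + (V + (- 1ℚ * A + ((M * g + M * g) * D * D + M * g * Z))))
        ≡⟨ cong (λ s → i * s) total-f ⟨
      mean l f
        ≡⟨ mean-sel l f ⟨
      mean (sel l) (f ∘ proj₁)
        ≡⟨ mean-cong (sel l) (λ {(y , r)} yr∈ → cong (λ s → q y * y + s) (potential-rest yr∈)) ⟨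
      mean (sel l) (λ (y , r) → q y * y + potential t r)
        ≤⟨ mean-mono (sel l) (λ {(y , r)} yr∈ → +-monoʳ-≤ (q y * y) (potential≤gain t r (small-sel yr∈ small))) ⟩
      mean (sel l) (λ (y , r) → q y * y + gain id t r)
        ≡⟨ gain-step id x xs ⟨
      gain id (suc t) l ∎
      where
      open ≤-Reasoning
      l = x ∷ xs
      q = quota n κ l
      g = wallis t
      i = inv (suc t)
      A = value l
      D = drift l
      Z = spread l
      V = ∑ l (λ y → q y * y)
      c = A - M * g * (D * D) - (M * g + M * g) * Z - (L + L) * ι t * g
      reduced : ℚ → ℚ
      reduced y = A - w y * y - M * g * ((D - dev y) * (D - dev y)) - (M * g + M * g) * (Z - dev y * dev y) - (L + L) * ι t * g
      f : ℚ → ℚ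
      f y = q y * y + reduced y
      potential-rest : ∀ {y r} → (y , r) ∈ sel l → potential t r ≡ reduced y
      potential-rest {y} {r} yr∈ = ≡.trans
        (cong₂ (λ a d → a - M * g * (d * d) - (M * g + M * g) * spread r - (L + L) * ι t * g)
          (∑-rest yr∈ (λ x → w x * x)) (∑-rest yr∈ dev))
        (cong (λ z → A - w y * y - M * g * ((D - dev y) * (D - dev y)) - (M * g + M * g) * z - (L + L) * ι t * g)
          (∑-rest yr∈ (λ x → dev x * dev x)))
      expand : ∀ A D Z M L g t b a z →
        b + (A - a - M * g * ((D - z) * (D - z)) - (M * g + M * g) * (Z - z * z) - (L + L) * t * g) ≡
        (A - M * g * (D * D) - (M * g + M * g) * Z - (L + L) * t * g)
          + (b + (- 1ℚ * a + ((M * g + M * g) * D * z + M * g * (z * z))))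
      expand = solve-∀ ℚ-ring
      total-f : ∑ l f ≡ ι (suc t) * c + (V + (- 1ℚ * A + ((M * g + M * g) * D * D + M * g * Z)))
      total-f = ≡.trans (∑-cong l (λ {y} _ → expand A D Z M L g (ι t) (q y * y) (w y * y) (dev y)))
        (≡.trans (∑-+ l (λ _ → c) _) (cong₂ _+_ (∑-const l c)
          (≡.trans (∑-+ l (λ y → q y * y) _) (cong (λ s → V + s)
            (≡.trans (∑-+ l (λ y → - 1ℚ * (w y * y)) _) (cong₂ _+_ (∑-* l (- 1ℚ) (λ y → w y * y))
              (≡.trans (∑-+ l (λ y → (M * g + M * g) * D * dev y) _)
                (cong₂ _+_ (∑-* l ((M * g + M * g) * D) dev) (∑-* l (M * g) (λ y → dev y * dev y))))))))))
      -- The last summand, a multiple of `(1ℚ + t) * i - 1ℚ`, vanishes once `i` is the reciprocal of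
      -- `1 + t`.
      identity : ∀ A D Z V M L g i t →
        i * ((1ℚ + t) * (A - M * g * (D * D) - (M * g + M * g) * Z - (L + L) * t * g) + (V + (- 1ℚ * A + ((M * g + M * g) * D * D + M * g * Z)))) ≡
        A - M * (g * (1ℚ - ½ * i)) * (D * D) - (M * (g * (1ℚ - ½ * i)) + M * (g * (1ℚ - ½ * i))) * Z - (L + L) * (1ℚ + t) * (g * (1ℚ - ½ * i))
          + (i * (V - (A - (M * g * (D * D) + L * (1ℚ + t) * g))) + ½ * i * (M * g) * (D * D))
          + ((1ℚ + t) * i - 1ℚ) * (A - M * g * (D * D) - (M * g + M * g) * Z - (L + L) * t * g - (L + L) * g)
      identity = solve-∀ ℚ-ring
      zero-out : ∀ a b → a + (1ℚ - 1ℚ) * b ≡ a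
      zero-out = solve-∀ ℚ-ring
      balance : i * (ι (suc t) * c + (V + (- 1ℚ * A + ((M * g + M * g) * D * D + M * g * Z)))) ≡
        potential (suc t) l + (i * (V - (A - (M * g * (D * D) + L * ι (suc t) * g))) + ½ * i * (M * g) * (D * D))
      balance = ≡.trans (identity A D Z V M L g i (ι t))
        (≡.trans (cong (λ e → potential (suc t) l + (i * (V - (A - (M * g * (D * D) + L * ι (suc t) * g))) + ½ * i * (M * g) * (D * D))
            + (e - 1ℚ) * (c - (L + L) * g)) (ι*inv t))
          (zero-out (potential (suc t) l + (i * (V - (A - (M * g * (D * D) + L * ι (suc t) * g))) + ½ * i * (M * g) * (D * D))) (c - (L + L) * g)))

-- Running a decision rule with limited capacity

run-nonneg : ∀ d c h {xs} → All InUnit xs → 0ℚ ≤ run d c h xs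
run-nonneg d c       h []                      = ≤-refl
run-nonneg d zero    h (_ ∷ _)                 = ≤-refl
run-nonneg d (suc c) h {x ∷ _} ((0≤x , _) ∷ p) with d h x
... | true  = +-nonneg 0≤x (run-nonneg d c (h ∷ʳ x) p)
... | false = run-nonneg d (suc c) (h ∷ʳ x) p

tally-id≤tally-one : ∀ d h {xs} → All InUnit xs → tally id d h xs ≤ tally (λ _ → 1ℚ) d h xs
tally-id≤tally-one d h []                      = ≤-refl
tally-id≤tally-one d h {x ∷ _} ((_ , x≤1) ∷ p) =
  +-mono-≤ (*-monoˡ (ind-nonneg (d h x)) x≤1) (tally-id≤tally-one d (h ∷ʳ x) p)

-- Each acceptance beyond the capacity loses at most 1.
tally≤run+excess : ∀ d c h {xs} z → All InUnit xs → 0ℚ ≤ z → tally (λ _ → 1ℚ) d h xs ≤ ι c + z →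
  tally id d h xs ≤ run d c h xs + z
tally≤run+excess d c       h z []        0≤z _ = ≤-trans 0≤z (≤-reflexive (sym (+-identityˡ z)))
tally≤run+excess d zero    h z p@(_ ∷ _) 0≤z ≤z = ≤-trans (tally-id≤tally-one d h p) ≤z
tally≤run+excess d (suc c) h {x ∷ xs} z (_ ∷ p) 0≤z ≤z with d h x
... | true  = ≤-trans (+-mono-≤ (≤-reflexive (*-identityˡ x)) (tally≤run+excess d c (h ∷ʳ x) z p 0≤z
                (≤-trans (≤-reflexive (cancel₁ T)) (≤-trans (+-monoʳ-≤ (- 1ℚ) ≤z) (≤-reflexive (cancel₂ (ι c) z))))))
                (≤-reflexive (sym (+-assoc x (run d c (h ∷ʳ x) xs) z)))
  where
  T = tally (λ _ → 1ℚ) d (h ∷ʳ x) xs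
  cancel₁ : ∀ t → t ≡ - 1ℚ + (1ℚ * 1ℚ + t)
  cancel₁ = solve-∀ ℚ-ring
  cancel₂ : ∀ c z → - 1ℚ + (1ℚ + c + z) ≡ c + z
  cancel₂ = solve-∀ ℚ-ring
... | false = ≤-trans (≤-reflexive (drop x (tally id d (h ∷ʳ x) xs))) (tally≤run+excess d (suc c) (h ∷ʳ x) z p 0≤z
                (≤-trans (≤-reflexive (sym (drop 1ℚ (tally (λ _ → 1ℚ) d (h ∷ʳ x) xs)))) ≤z))
  where
  drop : ∀ x t → 0ℚ * x + t ≡ t
  drop = solve-∀ ℚ-ring

-- Linear programming duality for topK

surplus : ℚ → ℚ → ℚ
surplus θ x = 0ℚ ⊔ (x - θ)

dual : ℕ → ℚ → List ℚ → ℚ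
dual k θ xs = ι k * θ + ∑ xs (surplus θ)

surplus-nonneg : ∀ θ x → 0ℚ ≤ surplus θ x
surplus-nonneg θ x = p≤p⊔q 0ℚ (x - θ)

-- Weak duality: an accepted item is worth at most `θ` plus its surplus, and each acceptance uses
-- one of the `c` units priced at `θ`.
run≤dual : ∀ d c h xs {θ} → 0ℚ ≤ θ → run d c h xs ≤ dual c θ xs
run≤dual d c       h []       {θ} 0≤θ = +-nonneg (*-nonneg (ι-nonneg c) 0≤θ) ≤-refl
run≤dual d zero    h (x ∷ xs) {θ} 0≤θ =
  +-nonneg (*-nonneg {0ℚ} {θ} ≤-refl 0≤θ) (∑-nonneg (x ∷ xs) (λ {y} _ → surplus-nonneg θ y))
run≤dual d (suc c) h (x ∷ xs) {θ} 0≤θ with d h x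
... | true  = ≤-trans (+-monoʳ-≤ x (run≤dual d c (h ∷ʳ x) xs 0≤θ))
    (≤-slack (surplus θ x - (x - θ)) (lemma x θ (ι c) (surplus θ x) (∑ xs (surplus θ))) (0≤y-x (p≤q⊔p 0ℚ (x - θ))))
  where
  lemma : ∀ x θ c s t → (1ℚ + c) * θ + (s + t) ≡ x + (c * θ + t) + (s - (x - θ))
  lemma = solve-∀ ℚ-ring
... | false = ≤-trans (run≤dual d (suc c) (h ∷ʳ x) xs 0≤θ)
    (≤-slack (surplus θ x) (lemma (ι (suc c) * θ) (surplus θ x) (∑ xs (surplus θ))) (surplus-nonneg θ x))
  where
  lemma : ∀ a s t → a + (s + t) ≡ a + t + s
  lemma = solve-∀ ℚ-ring

Descending : List ℚ → Set
Descending = AllPairs (flip _≤_)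

-- The price is the last value taken, or 0 when the list runs out early. In the recursion `b` is the
-- item just taken, so the price found in the tail does not exceed it and its surplus is the plain
-- difference.
dual≤take : ∀ k {zs b} → 0ℚ ≤ b → All InUnit zs → All (_≤ b) zs → Descending zs →
  ∃ λ θ → 0ℚ ≤ θ × θ ≤ b × dual k θ zs ≤ sumℚ (take k zs)
dual≤take zero    {zs} {b} 0≤b _ zs≤b _ = b , 0≤b , ≤-refl ,
  ≤-trans (+-mono-≤ (≤-reflexive (*-zeroˡ b)) (∑-mono zs {g = λ _ → 0ℚ} λ {z} z∈ → ⊔-lub ≤-refl (z-b≤0 z (All.lookup zs≤b z∈))))
          (≤-reflexive (≡.trans (+-identityˡ (∑ zs (λ _ → 0ℚ))) (≡.trans (∑-const zs 0ℚ) (*-zeroʳ (ι (length zs))))))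
  where
  z-b≤0 : ∀ z → z ≤ b → z - b ≤ 0ℚ
  z-b≤0 z z≤b = subst (z - b ≤_) (+-inverseʳ b) (+-monoˡ-≤ (- b) z≤b)
dual≤take (suc k) {[]} 0≤b _ _ _ = 0ℚ , ≤-refl , 0≤b , ≤-reflexive (≡.trans (+-identityʳ (ι (suc k) * 0ℚ)) (*-zeroʳ (ι (suc k))))
dual≤take (suc k) {z ∷ zs} 0≤b ((0≤z , _) ∷ zs∈) (z≤b ∷ _) (z≥ ∷ desc)
  with dual≤take k 0≤z zs∈ z≥ desc
... | θ , 0≤θ , θ≤z , ≤sum = θ , 0≤θ , ≤-trans θ≤z z≤b ,
  ≤-trans (≤-reflexive (lemma (ι k) θ (surplus θ z) (∑ zs (surplus θ))))
    (+-mono-≤ (≤-trans (+-monoʳ-≤ θ (⊔-lub (0≤y-x θ≤z) ≤-refl)) (≤-reflexive (cancel θ z))) ≤sum)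
  where
  lemma : ∀ k θ s t → (1ℚ + k) * θ + (s + t) ≡ (θ + s) + (k * θ + t)
  lemma = solve-∀ ℚ-ring
  cancel : ∀ θ z → θ + (z - θ) ≡ z
  cancel = solve-∀ ℚ-ring

ranked : List ℚ → List ℚ
ranked xs = reverse (sortℚ xs)

ranked-↭ : ∀ xs → ranked xs ↭ xs
ranked-↭ xs = ↭-trans (↭-reverse (sortℚ xs)) (Data.List.Sort.sort-↭ ≤-decTotalOrder xs)

reverse-AllPairs : ∀ {zs} → AllPairs _≤_ zs → Descending (reverse zs)
reverse-AllPairs []                     = []
reverse-AllPairs {z ∷ zs} (z≤ ∷ sorted) = subst Descending (sym (unfold-reverse z zs))
  (++⁺ (reverse-AllPairs sorted) ([] ∷ [])
    (All-resp-↭ (↭-sym (↭-reverse zs)) (All.map (λ z≤x → z≤x ∷ []) z≤)))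

ranked-Descending : ∀ xs → Descending (ranked xs)
ranked-Descending xs = reverse-AllPairs
  (Sorted⇒AllPairs (DecTotalOrder.totalOrder ≤-decTotalOrder) (Data.List.Sort.sort-↗ ≤-decTotalOrder xs))

dual≤topK : ∀ k {xs} → All InUnit xs → ∃ λ θ → 0ℚ ≤ θ × dual k θ xs ≤ topK k xs
dual≤topK k {xs} xs∈ with dual≤take k 0≤1 zs∈ (All.map proj₂ zs∈) (ranked-Descending xs)
  where
  zs∈ : All InUnit (ranked xs)
  zs∈ = All-resp-↭ (↭-sym (ranked-↭ xs)) xs∈
... | θ , 0≤θ , _ , ≤topK = θ , 0≤θ ,
  subst (λ s → ι k * θ + s ≤ topK k xs) (∑-↭ (surplus θ) (ranked-↭ xs)) ≤topK

-- The number of items actually taken replaces `k`, so an instance with fewer than `k` items is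
-- charged only for those it has.
take≤dual : ∀ k θ zs (f : ℚ → ℚ) → (∀ {z} → z ∈ zs → 0ℚ ≤ f z) → (∀ {z} → z ∈ zs → z ≤ θ + f z) →
  sumℚ (take k zs) ≤ ι (length (take k zs)) * θ + ∑ zs f
take≤dual zero    θ zs       f 0≤f ≤θ+f = +-nonneg (≤-reflexive (sym (*-zeroˡ θ))) (∑-nonneg zs 0≤f)
take≤dual (suc k) θ []       f 0≤f ≤θ+f = +-nonneg (≤-reflexive (sym (*-zeroˡ θ))) ≤-refl
take≤dual (suc k) θ (z ∷ zs) f 0≤f ≤θ+f = ≤-trans
  (+-mono-≤ (≤θ+f (here ≡.refl)) (take≤dual k θ zs f (0≤f ∘ there) (≤θ+f ∘ there)))
  (≤-reflexive (lemma (ι (length (take k zs))) θ (f z) (∑ zs f)))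
  where
  lemma : ∀ k θ s t → (θ + s) + (k * θ + t) ≡ (1ℚ + k) * θ + (s + t)
  lemma = solve-∀ ℚ-ring

length-top : ∀ k xs → length (take k (ranked xs)) ≡ k ⊓ length xs
length-top k xs = ≡.trans (length-take k (ranked xs)) (cong (k ⊓_) (↭-length (ranked-↭ xs)))

topK≡0 : ∀ k xs → k ⊓ length xs ≡ 0 → topK k xs ≡ 0ℚ
topK≡0 k xs none with take k (ranked xs) | ≡.trans (length-top k xs) none
... | [] | _ = ≡.refl

-- The algorithm and its regret

fromRules : List Decision → Σ ℕ (λ m → Fin (suc m) → Decision)
fromRules []       = 0 , λ _ _ _ → false
fromRules (d ∷ ds) = length ds , lookup (d ∷ ds)

algorithm : Algorithm
algorithm n k = fromRules (Rules.rules n (k ⊓ n) n)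

-- With `A` abstract and its value given by an equation, the `with` inside `expectedGain` can be
-- matched.
expectedGain-fromRules : ∀ A k xs ds → A (length xs) k ≡ fromRules ds → 0 ℕ.< length ds →
  expectedGain A k xs ≡ mean ds (λ d → mean (perms xs) (run d k []))
expectedGain-fromRules A k xs (d ∷ ds) eq _ with A (length xs) k | eq
... | _ | ≡.refl = begin
  avg (map (λ s → avg (map (run (lookup l s) k []) (perms xs))) (allFin (length l)))
    ≡⟨ avg-map (allFin (length l)) (λ s → avg (map (run (lookup l s) k []) (perms xs))) ⟩
  mean (allFin (length l)) (λ s → avg (map (run (lookup l s) k []) (perms xs)))
    ≡⟨ mean-cong (allFin (length l)) (λ {s} _ → avg-map (perms xs) (run (lookup l s) k [])) ⟩
  mean (allFin (length l)) (F ∘ lookup l)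
    ≡⟨ mean-map (lookup l) (allFin (length l)) F ⟨
  mean (map (lookup l) (allFin (length l))) F
    ≡⟨ cong (λ l → mean l F) (≡.trans (map-tabulate id (lookup l)) (tabulate-lookup l)) ⟩
  mean l F ∎
  where
  open ≡-Reasoning
  l = d ∷ ds
  F : Decision → ℚ
  F d = mean (perms xs) (run d k [])

ruleList : ℕ → List ℚ → List Decision
ruleList k xs = Rules.rules (length xs) (k ⊓ length xs) (length xs)

0<length-ruleList : ∀ k xs → 0 ℕ.< length (ruleList k xs)
0<length-ruleList k []       = s≤s z≤n
0<length-ruleList k (x ∷ xs) = Expectation.0<length-rules (length xs) (k ⊓ suc (length xs)) (suc (length xs))

expectedGain≡ : ∀ k xs → expectedGain algorithm k xs ≡ mean (ruleList k xs) (λ d → mean (perms xs) (run d k []))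
expectedGain≡ k xs = expectedGain-fromRules algorithm k xs (ruleList k xs) ≡.refl (0<length-ruleList k xs)

mean-nonneg : ∀ {A : Set} (l : List A) {f} → (∀ {x} → x ∈ l → 0ℚ ≤ f x) → 0ℚ ≤ mean l f
mean-nonneg l nn = *-nonneg (inv-nonneg (length l)) (∑-nonneg l nn)

expectedGain-nonneg : ∀ k {xs} → All InUnit xs → 0ℚ ≤ expectedGain algorithm k xs
expectedGain-nonneg k {xs} xs∈ = subst (0ℚ ≤_) (sym (expectedGain≡ k xs))
  (mean-nonneg (ruleList k xs) λ {d} _ → mean-nonneg (perms xs) λ ys∈ →
    run-nonneg d k [] (All-resp-↭ (↭-sym (perms-↭ xs ys∈)) xs∈))

expectedGain≤topK : ∀ k {xs} → All InUnit xs → expectedGain algorithm k xs ≤ topK k xs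
expectedGain≤topK k {xs} xs∈ with dual≤topK k xs∈
... | θ , 0≤θ , ≤topK = subst (_≤ topK k xs) (sym (expectedGain≡ k xs)) (≤-trans
  (mean-mono (ruleList k xs) λ {d} _ → mean-mono (perms xs) λ {ys} ys∈ → ≤-trans (run≤dual d k [] ys 0≤θ)
    (≤-reflexive (cong (λ s → ι k * θ + s) (∑-↭ (surplus θ) (perms-↭ xs ys∈)))))
  (≤-trans (≤-reflexive (≡.trans
      (mean-cong (ruleList k xs) (λ _ → mean-const (perms xs) (dual k θ xs) (0<length-perms xs)))
      (mean-const (ruleList k xs) (dual k θ xs) (0<length-ruleList k xs))))
    ≤topK))

-- An upper bound on the regret can be squared only because of this sign.
regret-nonneg : ∀ k {xs} → All InUnit xs → 0ℚ ≤ regret algorithm k xs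
regret-nonneg k xs∈ = 0≤y-x (expectedGain≤topK k xs∈)

-- With κ = min k n, every loss term is a multiple of k·wallis k ≈ √k.
module Regret (k-1 : ℕ) (x : ℚ) (xs : List ℚ) (l∈ : All InUnit (x ∷ xs)) where

  k n κ : ℕ
  k = suc k-1
  n = suc (length xs)
  κ = k ⊓ n

  l : List ℚ
  l = x ∷ xs

  open Analysis (length xs) κ (ℕₚ.m⊓n≤n k n) hiding (n)

  gk gn a four : ℚ
  gk   = wallis k
  gn   = wallis n
  a    = ι k * gk
  four = 1ℚ + 1ℚ + 1ℚ + 1ℚ

  0≤gk : 0ℚ ≤ gk
  0≤gk = wallis-nonneg k

  0≤gn : 0ℚ ≤ gn
  0≤gn = wallis-nonneg n

  0≤a : 0ℚ ≤ a
  0≤a = *-nonneg (ι-nonneg k) 0≤gk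

  small : Small n l
  small = ≡.refl , ℕₚ.≤-refl , l∈

  open Priced (prices small)

  -- At the final step the budget κt/n is `κ`, so the quotas of the full list are themselves the
  -- optimal fractional choice on the whole instance.
  w : ℚ → ℚ
  w = quota n κ l

  -- The factors `four` give L M = 16 (k `gk`²)(n `gn`²) ≥ 16 · 1/4 · 1/4 = 1.
  L M : ℚ
  L = four * (ι k * gk * gn)
  M = four * (ι n * gn * gk)

  1≤LM : 1ℚ ≤ L * M
  1≤LM = ≤-trans
    (*-monoˡ {z = four * four} (ι-nonneg 16)
      (*-mono {¼} {ι k * (gk * gk)} {¼} {ι n * (gn * gn)} (*-nonneg 0≤½ 0≤½) (*-nonneg (ι-nonneg n) (square-nonneg gn))
        (¼≤t*wallis² k-1) (¼≤t*wallis² (length xs))))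
    (≤-reflexive (lemma (ι k) gk (ι n) gn))
    where
    lemma : ∀ k g n h → (1ℚ + 1ℚ + 1ℚ + 1ℚ) * (1ℚ + 1ℚ + 1ℚ + 1ℚ) * (k * (g * g) * (n * (h * h))) ≡
      (1ℚ + 1ℚ + 1ℚ + 1ℚ) * (k * g * h) * ((1ℚ + 1ℚ + 1ℚ + 1ℚ) * (n * h * g))
    lemma = solve-∀ ℚ-ring

  open Potential w (quota-nonneg n κ l) (quota≤1 (length xs) κ l) L M
    (*-nonneg (ι-nonneg 4) (*-nonneg (*-nonneg (ι-nonneg k) 0≤gk) 0≤gn))
    (*-nonneg (ι-nonneg 4) (*-nonneg (*-nonneg (ι-nonneg n) 0≤gn) 0≤gk)) 1≤LM

  pn≡κ : p * ι n ≡ ι κ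
  pn≡κ = ≡.trans (lemma (ι κ) (inv n) (ι n)) (≡.trans (cong (λ s → ι κ * s) (ι*inv (length xs))) (*-identityʳ (ι κ)))
    where
    lemma : ∀ a b c → a * b * c ≡ a * (c * b)
    lemma = solve-∀ ℚ-ring

  ∑w≡κ : ∑ l w ≡ ι κ
  ∑w≡κ = ≡.trans ∑-quota pn≡κ

  κ≤k : ι κ ≤ ι k
  κ≤k = ι-mono (ℕₚ.m⊓n≤m k n)

  drift≡0 : drift l ≡ 0ℚ
  drift≡0 = ≡.trans (∑-+ l w (λ _ → - p)) (≡.trans (cong₂ _+_ ∑-quota (∑-const l (- p))) (lemma p (ι n)))
    where
    lemma : ∀ p n → p * n + n * - p ≡ 0ℚ
    lemma = solve-∀ ℚ-ring

  -- As for Bernoulli variances, `w² ≤ w` on [0,1] bounds the spread by κ - κp.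
  spread≤k : spread l ≤ ι k
  spread≤k = begin
    spread l                                                    ≤⟨ ∑-mono l {f = λ y → dev y * dev y} (λ {y} _ → ≤-slack (w y * (1ℚ - w y)) (pointwise (w y) p)
                                                                     (*-nonneg (quota-nonneg n κ l y) (0≤y-x (quota≤1 (length xs) κ l y)))) ⟩
    ∑ l (λ y → (1ℚ - p - p) * w y + p * p)                      ≡⟨ ∑-+ l (λ y → (1ℚ - p - p) * w y) (λ _ → p * p) ⟩
    ∑ l (λ y → (1ℚ - p - p) * w y) + ∑ l (λ _ → p * p)          ≡⟨ cong₂ _+_ (∑-* l (1ℚ - p - p) w) (∑-const l (p * p)) ⟩
    (1ℚ - p - p) * ∑ l w + ι n * (p * p)                        ≡⟨ cong₂ (λ s t → (1ℚ - p - p) * s + t) ∑w≡κ (≡.trans (reorder (ι n) p) (cong (_* p) pn≡κ)) ⟩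
    (1ℚ - p - p) * ι κ + ι κ * p                                ≤⟨ ≤-slack (ι κ * p) (collect p (ι κ)) (*-nonneg (ι-nonneg κ) (*-nonneg (ι-nonneg κ) (inv-nonneg n))) ⟩
    ι κ                                                         ≤⟨ κ≤k ⟩
    ι k                                                         ∎
    where
    open ≤-Reasoning
    pointwise : ∀ w p → (1ℚ - p - p) * w + p * p ≡ (w - p) * (w - p) + w * (1ℚ - w)
    pointwise = solve-∀ ℚ-ring
    reorder : ∀ n p → n * (p * p) ≡ p * n * p
    reorder = solve-∀ ℚ-ring
    collect : ∀ p κ → κ ≡ (1ℚ - p - p) * κ + κ * p + κ * p
    collect = solve-∀ ℚ-ring

  -- Comparing `w` with the weights 0 and 1 in `optimal` shows that `w z * (z - θ)` dominates the
  -- positive part of `z - θ`. It therefore serves as dual slack, and the budget `∑w≡κ` makes the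
  -- price terms cancel.
  topK≤value : topK k l ≤ value l
  topK≤value = begin
    topK k l
      ≤⟨ take≤dual k θ (ranked l) f f-nonneg f-dominates ⟩
    ι (length (take k (ranked l))) * θ + ∑ (ranked l) f
      ≡⟨ cong₂ (λ c s → ι c * θ + s) (length-top k l) (≡.trans (∑-↭ f (ranked-↭ l)) (∑-price l θ w)) ⟩
    ι κ * θ + (value l - θ * ∑ l w)
      ≡⟨ cong (λ s → ι κ * θ + (value l - θ * s)) ∑w≡κ ⟩
    ι κ * θ + (value l - θ * ι κ)
      ≡⟨ lemma (ι κ) θ (value l) ⟩
    value l ∎
    where
    open ≤-Reasoning
    f : ℚ → ℚ
    f z = w z * (z - θ)
    lemma : ∀ κ θ v → κ * θ + (v - θ * κ) ≡ v
    lemma = solve-∀ ℚ-ring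
    f-nonneg : ∀ {z} → z ∈ ranked l → 0ℚ ≤ f z
    f-nonneg {z} z∈ = ≤-trans (≤-reflexive (sym (*-zeroˡ (z - θ)))) (optimal (∈-resp-↭ (ranked-↭ l) z∈) ≤-refl 0≤1)
    f-dominates : ∀ {z} → z ∈ ranked l → z ≤ θ + f z
    f-dominates {z} z∈ = ≤-trans (≤-reflexive (split z θ)) (+-monoʳ-≤ θ (optimal (∈-resp-↭ (ranked-↭ l) z∈) 0≤1 ≤-refl))
      where
      split : ∀ z θ → z ≡ θ + 1ℚ * (z - θ)
      split = solve-∀ ℚ-ring

  -- On the whole instance the drift is 0. By n `gn`² ≤ 1/2, the spread term and the term in `L`
  -- cost at most `four * a` each.
  value≤gain : value l ≤ gain id n l + (1ℚ + 1ℚ) * four * a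
  value≤gain = ≤-trans
    (≤-slack ((four + four) * (ι n * (gn * gn)) * gk * (ι k - spread l) + (four * four) * (a * (½ - ι n * (gn * gn)))) value≡
      (+-nonneg
        (*-nonneg (*-nonneg (*-nonneg (ι-nonneg 8) (*-nonneg (ι-nonneg n) (square-nonneg gn))) 0≤gk) (0≤y-x spread≤k))
        (*-nonneg (ι-nonneg 16) (*-nonneg 0≤a (0≤y-x (t*wallis²≤½ n))))))
    (+-monoˡ-≤ ((1ℚ + 1ℚ) * four * a) (potential≤gain n l small))
    where
    identity : ∀ k g n h V Z →
      (V - (1ℚ + 1ℚ + 1ℚ + 1ℚ) * (n * h * g) * h * (0ℚ * 0ℚ)
        - ((1ℚ + 1ℚ + 1ℚ + 1ℚ) * (n * h * g) * h + (1ℚ + 1ℚ + 1ℚ + 1ℚ) * (n * h * g) * h) * Z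
        - ((1ℚ + 1ℚ + 1ℚ + 1ℚ) * (k * g * h) + (1ℚ + 1ℚ + 1ℚ + 1ℚ) * (k * g * h)) * n * h)
        + (1ℚ + 1ℚ) * (1ℚ + 1ℚ + 1ℚ + 1ℚ) * (k * g) ≡
      V + (((1ℚ + 1ℚ + 1ℚ + 1ℚ) + (1ℚ + 1ℚ + 1ℚ + 1ℚ)) * (n * (h * h)) * g * (k - Z)
        + ((1ℚ + 1ℚ + 1ℚ + 1ℚ) * (1ℚ + 1ℚ + 1ℚ + 1ℚ)) * (k * g * (½ - n * (h * h))))
    identity = solve-∀ ℚ-ring
    value≡ : potential n l + (1ℚ + 1ℚ) * four * a ≡
      value l + ((four + four) * (ι n * (gn * gn)) * gk * (ι k - spread l) + (four * four) * (a * (½ - ι n * (gn * gn))))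
    value≡ = ≡.trans
      (cong (λ D → value l - M * gn * (D * D) - (M * gn + M * gn) * spread l - (L + L) * ι n * gn + (1ℚ + 1ℚ) * four * a) drift≡0)
      (identity (ι k) gk (ι n) gn (value l) (spread l))

  -- A quadratic majorant of the overflow `count - κ`, admissible since `gk * a` is k `gk`² ≥ 1/4.
  -- Its variance part has mean at most `gk * ι κ`, again at most `a`.
  excess : Decision → List ℚ → ℚ
  excess d ys = gk * ((count d ys - ι κ) * (count d ys - ι κ)) + a

  gain≤expectedGain : gain id n l ≤ expectedGain algorithm k l + (1ℚ + 1ℚ) * a
  gain≤expectedGain = begin
    gain id n l
      ≤⟨ 𝔼-mono n l (λ {d} {ys} _ ys∈ → tally≤run+excess d k [] (excess d ys) (All-resp-↭ (↭-sym (perms-↭ l ys∈)) l∈)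
           (+-nonneg (*-nonneg 0≤gk (square-nonneg (count d ys - ι κ))) 0≤a) (count≤ d ys)) ⟩
    𝔼 n l (λ d ys → run d k [] ys + excess d ys)
      ≡⟨ 𝔼-+ n l (λ d → run d k []) excess ⟩
    𝔼 n l (λ d → run d k []) + 𝔼 n l excess
      ≡⟨ cong (_+ 𝔼 n l excess) (expectedGain≡ k l) ⟨
    expectedGain algorithm k l + 𝔼 n l excess
      ≤⟨ +-monoʳ-≤ (expectedGain algorithm k l) 𝔼-excess ⟩
    expectedGain algorithm k l + (1ℚ + 1ℚ) * a ∎
    where
    open ≤-Reasoning
    count≤ : ∀ d ys → count d ys ≤ ι k + excess d ys
    count≤ d ys = ≤-trans (≤-reflexive (split (count d ys) (ι κ))) (+-mono-≤ κ≤k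
      (linear≤quadratic (count d ys - ι κ) 0≤gk 0≤a (≤-trans (¼≤t*wallis² k-1) (≤-reflexive (reorder (ι k) gk)))))
      where
      split : ∀ c κ → c ≡ κ + (c - κ)
      split = solve-∀ ℚ-ring
      reorder : ∀ k g → k * (g * g) ≡ g * (k * g)
      reorder = solve-∀ ℚ-ring
    𝔼-excess : 𝔼 n l excess ≤ (1ℚ + 1ℚ) * a
    𝔼-excess = begin
      𝔼 n l excess
        ≡⟨ 𝔼-cong n l (λ {d} {ys} _ _ → expand gk (count d ys) (ι κ) a) ⟩
      𝔼 n l (λ d ys → gk * (count d ys * count d ys) + (- (gk * (ι κ + ι κ)) * count d ys + (gk * (ι κ * ι κ) + a)))
        ≡⟨ 𝔼-+ n l (λ d ys → gk * (count d ys * count d ys)) _ ⟩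
      𝔼 n l (λ d ys → gk * (count d ys * count d ys)) + 𝔼 n l (λ d ys → - (gk * (ι κ + ι κ)) * count d ys + (gk * (ι κ * ι κ) + a))
        ≡⟨ cong₂ _+_ (𝔼-* n l gk (λ d ys → count d ys * count d ys))
             (≡.trans (𝔼-+ n l (λ d ys → - (gk * (ι κ + ι κ)) * count d ys) _)
               (cong₂ _+_ (𝔼-* n l (- (gk * (ι κ + ι κ))) count) (𝔼-const n l (gk * (ι κ * ι κ) + a)))) ⟩
      gk * count² n l + (- (gk * (ι κ + ι κ)) * gain one n l + (gk * (ι κ * ι κ) + a))
        ≤⟨ +-mono-≤ (*-monoˡ 0≤gk (count²≤ n l small))
             (≤-reflexive (cong (λ s → - (gk * (ι κ + ι κ)) * s + (gk * (ι κ * ι κ) + a)) (gain-one n l small))) ⟩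
      gk * ((p * ι n) * (p * ι n) + p * ι n) + (- (gk * (ι κ + ι κ)) * (p * ι n) + (gk * (ι κ * ι κ) + a))
        ≡⟨ cong (λ s → gk * (s * s + s) + (- (gk * (ι κ + ι κ)) * s + (gk * (ι κ * ι κ) + a))) pn≡κ ⟩
      gk * (ι κ * ι κ + ι κ) + (- (gk * (ι κ + ι κ)) * ι κ + (gk * (ι κ * ι κ) + a))
        ≡⟨ collect gk (ι κ) a ⟩
      gk * ι κ + a
        ≤⟨ +-monoˡ-≤ a (*-monoˡ 0≤gk κ≤k) ⟩
      gk * ι k + a
        ≡⟨ double gk (ι k) ⟩
      (1ℚ + 1ℚ) * a ∎
      where
      expand : ∀ g c κ a → g * ((c - κ) * (c - κ)) + a ≡ g * (c * c) + (- (g * (κ + κ)) * c + (g * (κ * κ) + a))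
      expand = solve-∀ ℚ-ring
      collect : ∀ g κ a → g * (κ * κ + κ) + (- (g * (κ + κ)) * κ + (g * (κ * κ) + a)) ≡ g * κ + a
      collect = solve-∀ ℚ-ring
      double : ∀ g k → g * k + k * g ≡ (1ℚ + 1ℚ) * (k * g)
      double = solve-∀ ℚ-ring

  bound : ℚ
  bound = (1ℚ + 1ℚ) * (four + 1ℚ) * a

  regret≤bound : regret algorithm k l ≤ bound
  regret≤bound = begin
    topK k l - G                                                     ≤⟨ +-monoˡ-≤ (- G) (≤-trans topK≤value (≤-trans value≤gain (+-monoˡ-≤ ((1ℚ + 1ℚ) * four * a) gain≤expectedGain))) ⟩
    G + (1ℚ + 1ℚ) * a + (1ℚ + 1ℚ) * four * a - G                     ≡⟨ lemma G a ⟩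
    bound                                                            ∎
    where
    open ≤-Reasoning
    G = expectedGain algorithm k l
    lemma : ∀ G a → G + (1ℚ + 1ℚ) * a + (1ℚ + 1ℚ) * (1ℚ + 1ℚ + 1ℚ + 1ℚ) * a - G ≡ (1ℚ + 1ℚ) * (1ℚ + 1ℚ + 1ℚ + 1ℚ + 1ℚ) * a
    lemma = solve-∀ ℚ-ring

  -- The bound is 10 `a`, with 8 `a` from value and 2 `a` from overflow, and `a`² ≤ k/2. This gives
  -- 50 k; the next perfect square is 64, whence the constant 8.
  bound²≤64k : bound * bound ≤ ι 64 * ι k
  bound²≤64k = ≤-slack (ι 100 * (ι k * (½ - ι k * (gk * gk))) + ι 14 * ι k) (lemma (ι k) gk)
    (+-nonneg (*-nonneg (ι-nonneg 100) (*-nonneg (ι-nonneg k) (0≤y-x (t*wallis²≤½ k)))) (*-nonneg (ι-nonneg 14) (ι-nonneg k)))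
    where
    lemma : ∀ k g → ι 64 * k ≡
      ((1ℚ + 1ℚ) * (1ℚ + 1ℚ + 1ℚ + 1ℚ + 1ℚ) * (k * g)) * ((1ℚ + 1ℚ) * (1ℚ + 1ℚ + 1ℚ + 1ℚ + 1ℚ) * (k * g))
        + (ι 100 * (k * (½ - k * (g * g))) + ι 14 * k)
    lemma = solve-∀ ℚ-ring

square-mono : ∀ {x y} → 0ℚ ≤ x → x ≤ y → x * x ≤ y * y
square-mono 0≤x x≤y = *-mono 0≤x (≤-trans 0≤x x≤y) x≤y x≤y

regret≤0 : ∀ k {xs} → All InUnit xs → k ⊓ length xs ≡ 0 → regret algorithm k xs ≤ 0ℚ
regret≤0 k {xs} xs∈ none = ≤-trans (+-mono-≤ (≤-reflexive (topK≡0 k xs none)) (neg-antimono-≤ (expectedGain-nonneg k xs∈))) ≤-refl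

regret²≤64k : ∀ k {xs} → All InUnit xs → regret algorithm k xs * regret algorithm k xs ≤ ι 64 * ι k
regret²≤64k zero          xs∈ = square-mono (regret-nonneg 0 xs∈) (regret≤0 0 xs∈ ≡.refl)
regret²≤64k (suc k-1) {[]} xs∈ = ≤-trans (square-mono (regret-nonneg (suc k-1) xs∈) (regret≤0 (suc k-1) xs∈ ≡.refl))
  (*-nonneg (ι-nonneg 64) (ι-nonneg (suc k-1)))
regret²≤64k (suc k-1) {x ∷ xs} xs∈ = ≤-trans (square-mono (regret-nonneg (suc k-1) xs∈) regret≤bound) bound²≤64k
  where open Regret k-1 x xs xs∈

theoremA1 : Σ ℕ (λ C → Σ Algorithm (λ A →
    (k : ℕ) (xs : List ℚ) → All InUnit xs →
    regret A k xs * regret A k xs ≤ ((+ (C Data.Nat.* C Data.Nat.* k)) / 1)))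
theoremA1 = 8 , algorithm , λ k xs xs∈ →
  ≤-trans (regret²≤64k k xs∈) (≤-reflexive (≡.trans (sym (ι-* 64 k)) (ι≡/1 (64 ℕ.* k))))
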